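{- Let $\lambda$ be a partition of $n$ and $T,T'$ tabloids of shape $\lambda$. Then $T$ and $T'$ lie in the same connected component of the graph $\mathcal A_\lambda$ if and only if $\operatorname{charge}(T)\equiv\operatorname{charge}(T')\pmod{d_\lambda}$.
   Context: Fix $n\ge1$; $\overline i=i+n\mathbb Z$, $[\overline n]=\{\overline1,\dots,\overline n\}$. For a partition $\lambda$ of $n$, a tabloid of shape $\lambda$ is a sequence $(T_1,\dots,T_{\ell(\lambda)})$ of pairwise disjoint subsets of $[\overline n]$ with $|T_r|=\lambda_r$ and union $[\overline n]$; $T_r$ is row $r$, row 1 highest. $\tau(T)=\{\overline i: \overline i\text{ lies in a strictly higher row of }T\text{ than }\overline{i+1}\}$. Tabloids $T,T'$ are connected by a Knuth move if $T'$ is obtained from $T$ by exchanging $\overline i$ and $\overline{i+1}$ for some $i$, and neither of $\tau(T),\tau(T')$ contains the other. $\mathcal A_\lambda$ is the graph whose vertices are tabloids of shape $\lambda$ and whose edges are Knuth moves. Broken order: $\overline1<\dots<\overline n$. Local charge: if $\lambda_k=\lambda_{k+1}=m$, list $T_k$ as $\overline{a_1}<\dots<\overline{a_m}$ (broken order); for $t=1,\dots,m$ in turn match $\overline{a_t}$ with the smallest unmatched element of $T_{k+1}$ larger than $\overline{a_t}$ if one exists, otherwise with the smallest unmatched element of $T_{k+1}$; $\operatorname{lch}_k(T)$ is the number of $t$ with $\overline{a_t}$ larger than its match. If $\lambda_k\ne\lambda_{k+1}$, set $\operatorname{lch}_k(T)=0$. $\operatorname{charge}(T)=\sum_{i=1}^{\ell(\lambda)-1}i\cdot\operatorname{lch}_i(T)$.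 Finally $d_\lambda=\gcd(\lambda'_1,\lambda'_2,\dots)$, where $\lambda'$ is the conjugate partition (equivalently, the gcd of the multiplicities of the parts of $\lambda$).
   Formalization: The single shape λ = (1,1) with n = 2 is excluded, because there the claim fails: the two tabloids have τ = {1} and {2} and are joined by a Knuth move, but their charges 0 and 1 differ modulo d_λ = 2. -}

module Defs where

open import Data.Bool.Base using (if_then_else_)
open import Data.Fin.Base using (Fin; suc; toℕ; inject₁; _<_)
open import Data.Fin.Permutation.Components using (transpose)
open import Data.Fin.Properties using (_<?_)
open import Data.Fin.Subset using (Subset; _∈_; _∩_; _-_; Empty; ∣_∣)
open import Data.Fin.Subset.Properties using (_∈?_)
open import Data.List.Base as List using (List; []; _∷_; allFin; filter; foldr; head; length; map; upTo)
open import Data.List.Extrema.Nat using (max)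
open import Data.List.Relation.Unary.All using (All)
open import Data.List.Relation.Unary.Linked using (Linked)
open import Data.Maybe.Base using (Maybe; just; nothing; _<∣>_)
open import Data.Nat.Base as ℕ using (ℕ; suc; pred; _*_; _≥_; NonZero)
open import Data.Nat.Divisibility using (_∣_)
open import Data.Nat.DivMod using (_mod_)
open import Data.Nat.GCD using (gcd)
open import Data.Nat.ListAction using (sum)
open import Data.Nat.Properties using (_≟_; _≤?_)
open import Data.Product.Base using (_×_; _,_; ∃; ∃₂)
open import Data.Vec.Base as Vec using (Vec)
open import Function.Bundles using (_⇔_)
open import Level using (0ℓ)
open import Relation.Binary.Construct.Closure.Equivalence using (EqClosure)
open import Relation.Binary.Core using (Rel)
open import Relation.Binary.PropositionalEquality using (_≡_; _≢_)
open import Relation.Nullary using (¬_)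
open import Relation.Nullary.Decidable using (does)
open import Relation.Unary using (Pred; _⊆_)

-- Conventions.  The residue class of j + 1, for 0 ≤ j < n, is the element of
-- Fin n with value j; the broken order is then the usual order of Fin n.
-- Rows and parts are likewise indexed from 0, row 0 being the highest.

record Partition (n : ℕ) : Set where
  field
    parts      : List ℕ
    decreasing : Linked _≥_ parts
    positive   : All NonZero parts
    total      : sum parts ≡ n

  #parts : ℕ
  #parts = length parts

  part : Fin #parts → ℕ
  part = List.lookup parts

  conjugate : List ℕ
  conjugate = map (λ j → length (filter (suc j ≤?_) parts)) (upTo (max 0 parts))

  d : ℕ
  d = foldr gcd 0 conjugate

open Partition public using (parts; #parts; part; conjugate; d)

-- The conditions on the rows are irrelevant fields, so that tabloids with the
-- same rows are equal.
record Tabloid {n : ℕ} (lam : Partition n) : Set where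
  field
    rows : Vec (Subset n) (#parts lam)

  row : Fin (#parts lam) → Subset n
  row = Vec.lookup rows

  field
    .disjoint : ∀ r s → r ≢ s → Empty (row r ∩ row s)
    .sizes    : ∀ r → ∣ row r ∣ ≡ part lam r
    .covering : ∀ x → ∃ λ r → x ∈ row r

open Tabloid public using (rows; row)

next : ∀ {n} .{{_ : NonZero n}} → Fin n → Fin n
next {n} i = suc (toℕ i) mod n

module _ {n : ℕ} .{{_ : NonZero n}} {lam : Partition n} where

  τ : Tabloid lam → Pred (Fin n) 0ℓ
  τ T i = ∃₂ λ r s → i ∈ row T r × next i ∈ row T s × r < s

  Exchanged : Fin n → Fin n → Rel (Tabloid lam) 0ℓ
  Exchanged i j T T' = ∀ r x → x ∈ row T' r ⇔ transpose i j x ∈ row T r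

  KnuthMove : Rel (Tabloid lam) 0ℓ
  KnuthMove T T' =
    (∃ λ i → Exchanged i (next i) T T') × ¬ (τ T ⊆ τ T') × ¬ (τ T' ⊆ τ T)

  SameComponent : Rel (Tabloid lam) 0ℓ
  SameComponent = EqClosure KnuthMove

-- In increasing (broken) order.
elements : ∀ {n} → Subset n → List (Fin n)
elements {n} p = filter (_∈? p) (allFin n)

-- The smallest element of U larger than a if there is one, otherwise the
-- smallest element of U.
partner : ∀ {n} → Fin n → Subset n → Maybe (Fin n)
partner a U = head (filter (a <?_) (elements U)) <∣> head (elements U)

-- The second argument is the set of elements still unmatched.  It is never
-- exhausted early when the two rows have the same size.
matching : ∀ {n} → List (Fin n) → Subset n → List (Fin n × Fin n)
matching []       U = []
matching (a ∷ as) U with partner a U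
... | just b  = (a , b) ∷ matching as (U - b)
... | nothing = []

descents : ∀ {n} → List (Fin n × Fin n) → ℕ
descents ps = length (filter (λ (a , b) → b <? a) ps)

-- An index k : Fin (pred ℓ) stands for the pair of consecutive rows
-- upper k and lower k among ℓ rows.
upper lower : ∀ {ℓ} → Fin (pred ℓ) → Fin ℓ
upper {suc ℓ} k = inject₁ k
lower {suc ℓ} k = suc k

module _ {n : ℕ} {lam : Partition n} where

  lch : Tabloid lam → Fin (pred (#parts lam)) → ℕ
  lch T k =
    if does (part lam (upper k) ≟ part lam (lower k))
    then descents (matching (elements (row T (upper k))) (row T (lower k)))
    else 0

  -- The factor suc (toℕ k) is the 1-based index of the row upper k.
  charge : Tabloid lam → ℕ
  charge T = sum (map (λ k → suc (toℕ k) * lch T k) (allFin (pred (#parts lam))))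

infix 4 _≡_[mod_]

_≡_[mod_] : ℕ → ℕ → ℕ → Set
a ≡ b [mod m ] = m ∣ ℕ.∣ a - b ∣

{-# OPTIONS --safe #-}

-- A tabloid is the word whose x-th letter is the row of x, and a Knuth move is
-- a plactic relation applied to three cyclically consecutive letters.
--
-- Up to rotation every word is equivalent to a weakly decreasing one D: insert
-- the letter standing before a decreasing suffix into it à la Schensted, and
-- rotate the letter bumped out to the front.  The word Y formed by the columns
-- 1 2 … h, one for each part h of the conjugate partition, is fixed up to
-- equivalence by the rotation by h, since the columns commute plactically.
-- Hence rotation by d fixes the class of D, and every word of the given content
-- is equivalent to one of the rotations of D, taken modulo d.
--
-- The local charge counts the unpaired closing brackets when k is read as "("
-- and k + 1 as ")".  Plactic relations within the word preserve it, and a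
-- rotation by one step changes the charge by 1 modulo d, because the last row
-- of each block of equal rows has an index divisible by d.  So the charge
-- modulo d is an invariant that tells the rotations of D apart.

module Submission where

open import Defs
open import Data.Bool.Base using (true; false; if_then_else_)
open import Data.Empty using (⊥-elim-irr)
open import Data.Fin.Base as Fin using (Fin; zero; suc; toℕ; fromℕ; fromℕ<; inject₁)
open import Data.Fin.Patterns using (0F; 1F; 2F)
open import Data.Fin.Permutation.Components using (transpose)
open import Data.Fin.Properties as Fin using (toℕ-injective; toℕ-fromℕ<; toℕ-inject₁; toℕ-fromℕ; toℕ<n; any?)
open import Data.Fin.Subset using (Subset; _∈_; _∉_; _-_; _─_; ∣_∣; ⁅_⁆; inside; outside)
open import Data.Fin.Subset.Properties using (_∈?_; drop-there; x∈p∧x≢y⇒x∈p-y; p─q⊆p; x∈⁅x⁆; x∈p∩q⁺; x∈p∩q⁻; ⊆-antisym)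
open import Data.List.Base using (List; []; _∷_; _++_; _∷ʳ_; [_]; _ʳ++_; allFin; concat; filter; foldr; head; length; lookup; map; reverse; tabulate; upTo)
open import Data.List.Extrema.Nat using (max; xs≤max)
open import Data.List.Membership.Propositional using () renaming (_∈_ to _∈ˡ_)
open import Data.List.Membership.Propositional.Properties using (∈-∃++; ∈-allFin; ∈-filter⁺; ∈-filter⁻; ∈-map⁺; ∈-upTo⁺)
open import Data.List.Properties using (++-assoc; ++-identityʳ; ++-ʳ++; filter-++; filter-accept; filter-all; filter-none; filter-reject; filter-≐; length-++; length-tabulate; length-upTo; map-++; map-tabulate; reverse-involutive; tabulate-cong; tabulate-lookup; upTo-∷ʳ; ʳ++-defn; ∷-injectiveʳ; ∷-injectiveˡ)
open import Data.List.Relation.Binary.Permutation.Propositional using (_↭_; ↭-refl; ↭-sym; ↭-trans; prep; swap)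
open import Data.List.Relation.Binary.Permutation.Propositional.Properties using (All-resp-↭; drop-∷; filter-↭; shift; ↭-empty-inv; ↭-length; ∈-resp-↭; ∷↭∷ʳ)
open import Data.List.Relation.Unary.All as All using (All; []; _∷_)
open import Data.List.Relation.Unary.All.Properties as All using (++⁺; all-upTo; tabulate⁺; tabulate⁻)
open import Data.List.Relation.Unary.AllPairs as AllPairs using (AllPairs; []; _∷_)
import Data.List.Relation.Unary.AllPairs.Properties as AllPairs
open import Data.List.Relation.Unary.Any using (here; there)
open import Data.List.Relation.Unary.Linked.Properties using (Linked⇒AllPairs)
open import Data.Maybe.Base using (just; _<∣>_)
open import Data.Nat.Base using (ℕ; zero; suc; pred; _+_; _*_; _∸_; _≤_; _<_; _≥_; s≤s; z≤n; NonZero)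
open import Data.Nat.Divisibility using (_∣_; divides; ∣-trans; ∣m+n∣m⇒∣n; n∣m*n)
open import Data.Nat.DivMod using (_%_; m%n<n; m<n⇒m%n≡m; n%n≡0)
open import Data.Nat.GCD using (gcd; gcd[m,n]∣m; gcd[m,n]∣n; gcd-GCD; module Bézout)
open import Data.Nat.Induction using (<-wellFounded)
open import Data.Nat.ListAction using (sum)
open import Data.Nat.Properties
open import Data.Nat.Solver using (module +-*-Solver)
open import Data.Product.Base using (_×_; _,_; ∃; ∃₂; proj₁; proj₂)
open import Data.Sum.Base using (_⊎_; inj₁; inj₂)
open import Data.Vec.Base as Vec using ([]; _∷_; here; there)
open import Data.Vec.Properties as Vec using (lookup∘tabulate; tabulate∘lookup; []=⇒lookup; lookup⇒[]=)
open import Function.Base using (_∘_; id)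
open import Function.Bundles using (_⇔_; mk⇔; Equivalence)
open import Induction.WellFounded using (Acc; acc)
open import Level using (0ℓ)
open import Relation.Binary.Construct.Closure.Equivalence as EqClosure using ()
open import Relation.Binary.Construct.Closure.ReflexiveTransitive using (ε; _◅_)
open import Relation.Binary.Construct.Closure.Symmetric using (fwd; bwd)
open import Relation.Binary.Core using (Rel)
open import Relation.Binary.Definitions using (tri<; tri≈; tri>)
open import Relation.Binary.PropositionalEquality using (_≡_; _≢_; refl; sym; trans; cong; cong₂; subst; subst₂; module ≡-Reasoning)
open import Relation.Nullary using (¬_; ¬?; Dec; yes; no; does; contradiction; recompute; _×-dec_)
open import Relation.Nullary.Decidable using (dec-true; dec-false)
open import Relation.Unary using (Pred; Decidable; _⊆_)


-- Two difficulties shape the argument. The local charge is 0 by definition where consecutive rows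
-- differ in size, and this zero does not follow the rotations of a word. Modulo `d` it need not: at
-- such a place, and at the last row, the weight is itself a part of the conjugate partition, so the
-- term may be given any value. Hence `wordCharge` counts brackets for every `k` alike, and a
-- rotation acts on it by a uniform formula. The other difficulty is that nothing in the decreasing
-- word shows that its class recurs after `d` rotations. The word of columns shows its periods
-- openly, and being equivalent to a rotation of the decreasing word it hands them over. The periods
-- of a class are closed under addition and cancellation, so Bézout's identity leads from the parts
-- of the conjugate to their gcd. Describing Knuth moves by three consecutive letters takes at least
-- three positions on the circle; smaller `n` is settled separately.

-- Rotations of words

rotate : ∀ {A : Set} → List A → List A
rotate []       = []
rotate (x ∷ xs) = xs ∷ʳ x

rotations : ∀ {A : Set} → ℕ → List A → List A
rotations zero    w = w
rotations (suc k) w = rotate (rotations k w)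

module _ {A : Set} where

  rotations-+ : ∀ j k (w : List A) → rotations (j + k) w ≡ rotations j (rotations k w)
  rotations-+ zero    k w = refl
  rotations-+ (suc j) k w = cong rotate (rotations-+ j k w)

  rotations-rotate : ∀ k (w : List A) → rotations k (rotate w) ≡ rotate (rotations k w)
  rotations-rotate zero    w = refl
  rotations-rotate (suc k) w = cong rotate (rotations-rotate k w)

  rotations-++ : ∀ (u v : List A) → rotations (length u) (u ++ v) ≡ v ++ u
  rotations-++ []      v = sym (++-identityʳ v)
  rotations-++ (x ∷ u) v = begin
    rotate (rotations (length u) (x ∷ u ++ v))  ≡⟨ rotations-rotate (length u) (x ∷ u ++ v) ⟨
    rotations (length u) ((u ++ v) ∷ʳ x)        ≡⟨ cong (rotations (length u)) (++-assoc u v [ x ]) ⟩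
    rotations (length u) (u ++ (v ∷ʳ x))        ≡⟨ rotations-++ u (v ∷ʳ x) ⟩
    (v ∷ʳ x) ++ u                               ≡⟨ ++-assoc v [ x ] u ⟩
    v ++ x ∷ u                                  ∎
    where open ≡-Reasoning

  rotations-length : ∀ (w : List A) → rotations (length w) w ≡ w
  rotations-length w = subst (λ v → rotations (length w) v ≡ w) (++-identityʳ w) (rotations-++ w [])

  rotate-↭ : ∀ (w : List A) → rotate w ↭ w
  rotate-↭ []      = ↭-refl
  rotate-↭ (x ∷ w) = ↭-sym (∷↭∷ʳ x w)

  rotations-↭ : ∀ k (w : List A) → rotations k w ↭ w
  rotations-↭ zero    w = ↭-refl
  rotations-↭ (suc k) w = ↭-trans (rotate-↭ (rotations k w)) (rotations-↭ k w)

-- Knuth equivalence of linear and of circular words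

infix 4 _⟶_ _≈_ _∼_
infix 8 _⁻¹
infixr 5 _⨾_

-- Exchanging neighbours a < b destroys one element of τ.  Another is created
-- exactly when a neighbour m satisfies a ≤ m < b (before the pair) or
-- a < m ≤ b (after it).
data _⟶_ : Rel (List ℕ) 0ℓ where
  knuth₁ : ∀ {m a b} v → a ≤ m → m < b → m ∷ a ∷ b ∷ v ⟶ m ∷ b ∷ a ∷ v
  knuth₂ : ∀ {a b m} v → a < m → m ≤ b → a ∷ b ∷ m ∷ v ⟶ b ∷ a ∷ m ∷ v

-- The plactic congruence of linear words. A move acts on the first three letters; `prep` carries it
-- further inside, as `turn` does in `_∼_`.
data _≈_ : Rel (List ℕ) 0ℓ where
  move  : ∀ {w w'} → w ⟶ w' → w ≈ w'
  refl  : ∀ {w} → w ≈ w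
  _⁻¹   : ∀ {w w'} → w ≈ w' → w' ≈ w
  _⨾_   : ∀ {u v w} → u ≈ v → v ≈ w → u ≈ w
  prep  : ∀ x {w w'} → w ≈ w' → x ∷ w ≈ x ∷ w'

-- Knuth equivalence of words written around a circle with marked positions:
-- a word is not identified with its rotations, but a move may be made anywhere.
data _∼_ : Rel (List ℕ) 0ℓ where
  move  : ∀ {w w'} → w ⟶ w' → w ∼ w'
  refl  : ∀ {w} → w ∼ w
  _⁻¹   : ∀ {w w'} → w ∼ w' → w' ∼ w
  _⨾_   : ∀ {u v w} → u ∼ v → v ∼ w → u ∼ w
  turn  : ∀ {w w'} → w ∼ w' → rotate w ∼ rotate w'

⟶⇒↭ : ∀ {w w'} → w ⟶ w' → w ↭ w'
⟶⇒↭ (knuth₁ v _ _) = prep _ (swap _ _ ↭-refl)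
⟶⇒↭ (knuth₂ v _ _) = swap _ _ ↭-refl

∼⇒↭ : ∀ {w w'} → w ∼ w' → w ↭ w'
∼⇒↭ (move p)    = ⟶⇒↭ p
∼⇒↭ refl        = ↭-refl
∼⇒↭ (p ⁻¹)      = ↭-sym (∼⇒↭ p)
∼⇒↭ (p ⨾ q)     = ↭-trans (∼⇒↭ p) (∼⇒↭ q)
∼⇒↭ (turn {w} {w'} p) = ↭-trans (rotate-↭ w) (↭-trans (∼⇒↭ p) (↭-sym (rotate-↭ w')))

≡⇒∼ : ∀ {w w'} → w ≡ w' → w ∼ w'
≡⇒∼ refl = refl

≡⇒≈ : ∀ {w w'} → w ≡ w' → w ≈ w'
≡⇒≈ refl = refl

turns : ∀ k {w w'} → w ∼ w' → rotations k w ∼ rotations k w'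
turns zero    p = p
turns (suc k) p = turn (turns k p)

-- Rotation has finite order: `length w` further turns, one less than the length of `x ∷ w`, undo
-- it. They undo it on both sides because equivalent words have the same length.
rotate-reflects-∼ : ∀ {w w'} → rotate w ∼ rotate w' → w ∼ w'
rotate-reflects-∼ {[]} {[]} p = refl
rotate-reflects-∼ {[]} {x ∷ w'} p with () ← trans (↭-length (∼⇒↭ p)) (↭-length (rotate-↭ (x ∷ w')))
rotate-reflects-∼ {x ∷ w} {w'} p = subst₂ _∼_ (back (x ∷ w) refl) (back w' (sym same)) (turns (length w) p)
  where
  same : length (x ∷ w) ≡ length w'
  same = trans (sym (↭-length (rotate-↭ (x ∷ w)))) (trans (↭-length (∼⇒↭ p)) (↭-length (rotate-↭ w')))
  back : ∀ u → length u ≡ suc (length w) → rotations (length w) (rotate u) ≡ u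
  back u eq = trans (rotations-rotate (length w) u) (trans (cong (λ k → rotations k u) (sym eq)) (rotations-length u))

rotations-reflects-∼ : ∀ k {w w'} → rotations k w ∼ rotations k w' → w ∼ w'
rotations-reflects-∼ zero    p = p
rotations-reflects-∼ (suc k) p = rotations-reflects-∼ k (rotate-reflects-∼ p)

⟶-++ : ∀ {w w'} → w ⟶ w' → ∀ u → w ++ u ⟶ w' ++ u
⟶-++ (knuth₁ v p q) u = knuth₁ (v ++ u) p q
⟶-++ (knuth₂ v p q) u = knuth₂ (v ++ u) p q

-- The circular relation has no rule for a common prefix. So `u` is rotated to the end, where a move
-- tolerates it, and the rotation is cancelled afterwards. A general `u` lets `prep` be absorbed
-- into the prefix.
≈⇒∼-after : ∀ u {w w'} → w ≈ w' → u ++ w ∼ u ++ w'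
≈⇒∼-after u (move {w} {w'} p) =
  rotations-reflects-∼ (length u) (subst₂ _∼_ (sym (rotations-++ u w)) (sym (rotations-++ u w')) (move (⟶-++ p u)))
≈⇒∼-after u refl = refl
≈⇒∼-after u (p ⁻¹) = ≈⇒∼-after u p ⁻¹
≈⇒∼-after u (p ⨾ q) = ≈⇒∼-after u p ⨾ ≈⇒∼-after u q
≈⇒∼-after u (prep x {w} {w'} p) = subst₂ _∼_ (++-assoc u [ x ] w) (++-assoc u [ x ] w') (≈⇒∼-after (u ∷ʳ x) p)

≈⇒∼ : ∀ {w w'} → w ≈ w' → w ∼ w'
≈⇒∼ = ≈⇒∼-after []

++⁺ˡ : ∀ u {w w'} → w ≈ w' → u ++ w ≈ u ++ w'
++⁺ˡ []      p = p
++⁺ˡ (x ∷ u) p = prep x (++⁺ˡ u p)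

++⁺ʳ : ∀ {w w'} → w ≈ w' → ∀ u → w ++ u ≈ w' ++ u
++⁺ʳ (move p)    u = move (⟶-++ p u)
++⁺ʳ refl        u = refl
++⁺ʳ (p ⁻¹)      u = ++⁺ʳ p u ⁻¹
++⁺ʳ (p ⨾ q)     u = ++⁺ʳ p u ⨾ ++⁺ʳ q u
++⁺ʳ (prep x p)  u = prep x (++⁺ʳ p u)

-- Schensted insertion

Decreasing : List ℕ → Set
Decreasing = AllPairs _≥_

-- The letter that `b` has just passed witnesses its next exchange: `d ≤ m < b` at first, then `d`
-- takes the place of `m`.
move-to-end : ∀ {m b} D → Decreasing (m ∷ D) → m < b → m ∷ b ∷ D ≈ m ∷ (D ∷ʳ b)
move-to-end []      _                   m<b = refl
move-to-end (d ∷ D) ((d≤m ∷ _) ∷ D↘) m<b =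
  move (knuth₁ D d≤m m<b) ⁻¹ ⨾ prep _ (move-to-end D D↘ (≤-<-trans d≤m m<b))

-- The letter bumped out of D is the smallest one larger than c.
record Bumped (c : ℕ) (D : List ℕ) : Set where
  field
    inserted    : List ℕ
    bumped      : ℕ
    equivalent  : c ∷ D ≈ inserted ∷ʳ bumped
    decreasing  : Decreasing inserted
    bounded     : ∀ {z} → z ≥ c → All (z ≥_) D → All (z ≥_) inserted
    smaller     : sum inserted < sum D

insert : ∀ c d D → Decreasing (d ∷ D) → c < d → Bumped c (d ∷ D)
insert c d [] _ c<d = record
  { inserted = [ c ] ; bumped = d ; equivalent = refl ; decreasing = [] ∷ []
  ; bounded = λ c≤z _ → c≤z ∷ [] ; smaller = +-monoˡ-< 0 c<d }
insert c d (d' ∷ D) ((d'≤d ∷ D≤d) ∷ D↘) c<d with c <? d'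
-- `d'` exceeds `c` too, so `d` is not the letter to be bumped: it moves in front of `c`, with `d'`
-- as witness.
... | yes c<d' = record
  { inserted = d ∷ inserted ; bumped = bumped
  ; equivalent = move (knuth₂ D c<d' d'≤d) ⨾ prep d equivalent
  ; decreasing = bounded (<⇒≤ c<d) (d'≤d ∷ D≤d) ∷ decreasing
  ; bounded = λ { c≤z (d≤z ∷ D≤z) → d≤z ∷ bounded c≤z D≤z }
  ; smaller = +-monoʳ-< d smaller }
  where open Bumped (insert c d' D D↘ c<d')
-- `d` is the last, hence smallest, letter exceeding `c`. So `c` takes its place in the row and
-- witnesses the first step of `d` towards the end.
insert c d (d' ∷ D) ((d'≤d ∷ D≤d) ∷ D↘@(D≤d' ∷ _)) c<d | no c≮d' = record
  { inserted = c ∷ d' ∷ D ; bumped = d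
  ; equivalent = move-to-end (d' ∷ D) c∷D↘ c<d
  ; decreasing = c∷D↘
  ; bounded = λ { c≤z (_ ∷ D≤z) → c≤z ∷ D≤z }
  ; smaller = +-monoˡ-< (d' + sum D) c<d }
  where
  d'≤c = ≮⇒≥ c≮d'
  c∷D↘ : Decreasing (c ∷ d' ∷ D)
  c∷D↘ = (d'≤c ∷ All.map (λ x≤d' → ≤-trans x≤d' d'≤c) D≤d') ∷ D↘

RotatedRow : List ℕ → Set
RotatedRow w = ∃₂ λ k D → Decreasing D × w ∼ rotations k D

-- The letters outside the row D stand before it in reversed order.  Inserting
-- the last of them either lengthens D or, after a rotation, decreases its sum.
RowsAfter : ℕ → Set
RowsAfter k = ∀ u → length u ≡ k → ∀ D → Decreasing D → RotatedRow (u ʳ++ D)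

extend-row : ∀ {k} → RowsAfter k → ∀ u → length u ≡ suc k → ∀ D → Decreasing D → Acc _<_ (sum D) → RotatedRow (u ʳ++ D)
extend-row ih (c ∷ u) len []      D↘ _ = ih u (suc-injective len) [ c ] ([] ∷ [])
extend-row ih (c ∷ u) len (d ∷ D) D↘@(D≤d ∷ _) (acc rec) with c <? d
... | no c≮d = ih u (suc-injective len) (c ∷ d ∷ D)
  ((≮⇒≥ c≮d ∷ All.map (λ x≤d → ≤-trans x≤d (≮⇒≥ c≮d)) D≤d) ∷ D↘)
-- `u` lists the outer letters from right to left, so appending `bumped` to it puts that letter at
-- the front of the word. The number of outer letters stays the same while the sum of the row drops.
... | yes c<d = after-rotation
  (extend-row ih (u ∷ʳ bumped) (trans (length-++ u) (trans (+-comm (length u) 1) len)) inserted decreasing (rec smaller))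
  where
  open Bumped (insert c d D D↘ c<d)
  open ≡-Reasoning
  rearranged : u ʳ++ (inserted ∷ʳ bumped) ≡ rotate ((u ∷ʳ bumped) ʳ++ inserted)
  rearranged = begin
    u ʳ++ (inserted ∷ʳ bumped)              ≡⟨ ʳ++-defn u ⟩
    reverse u ++ (inserted ∷ʳ bumped)       ≡⟨ ++-assoc (reverse u) inserted [ bumped ] ⟨
    (reverse u ++ inserted) ∷ʳ bumped       ≡⟨ cong (_∷ʳ bumped) (ʳ++-defn u) ⟨
    rotate (bumped ∷ (u ʳ++ inserted))      ≡⟨ cong rotate (++-ʳ++ u) ⟨
    rotate ((u ∷ʳ bumped) ʳ++ inserted)     ∎
  step : u ʳ++ (c ∷ d ∷ D) ∼ rotate ((u ∷ʳ bumped) ʳ++ inserted)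
  step = subst₂ _∼_ (sym (ʳ++-defn u)) (trans (sym (ʳ++-defn u)) rearranged) (≈⇒∼-after (reverse u) equivalent)
  after-rotation : RotatedRow ((u ∷ʳ bumped) ʳ++ inserted) → RotatedRow (u ʳ++ (c ∷ d ∷ D))
  after-rotation (i , E , E↘ , p) = suc i , E , E↘ , (step ⨾ turn p)

rows-after : ∀ k → RowsAfter k
rows-after zero    []  _   D D↘ = 0 , D , D↘ , refl
rows-after (suc k) u   len D D↘ = extend-row (rows-after k) u len D D↘ (<-wellFounded (sum D))

rotated-row : ∀ w → RotatedRow w
rotated-row w = subst RotatedRow (trans (ʳ++-defn (reverse w)) (trans (++-identityʳ _) (reverse-involutive w)))
  (rows-after _ (reverse w) refl [] [])

-- Columns

interval : ℕ → ℕ → List ℕ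
interval s zero    = []
interval s (suc k) = s ∷ interval (suc s) k

column : ℕ → List ℕ
column = interval 0

length-interval : ∀ s k → length (interval s k) ≡ k
length-interval s zero    = refl
length-interval s (suc k) = cong suc (length-interval (suc s) k)

interval-bounded : ∀ s k → All (_< s + k) (interval s k)
interval-bounded s zero    = []
interval-bounded s (suc k) =
  m<m+n s (s≤s z≤n) ∷ subst (λ t → All (_< t) (interval (suc s) k)) (sym (+-suc s k)) (interval-bounded (suc s) k)

-- The interval letter that `x` has just passed witnesses its exchange with the next one.
small-letter-to-end : ∀ {x m} k → x ≤ m → m ∷ x ∷ interval (suc m) k ≈ m ∷ (interval (suc m) k ∷ʳ x)
small-letter-to-end zero    x≤m = refl
small-letter-to-end {m = m} (suc k) x≤m =
  move (knuth₁ _ x≤m (n<1+n m)) ⨾ prep m (small-letter-to-end k (m≤n⇒m≤1+n x≤m))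

-- Interval letters below `x` move in front of it, each witnessed by its successor. When `x` meets
-- its own copy, one of the two stays and the other goes to the end by `small-letter-to-end`.
letter-commutes : ∀ {x} s k → s ≤ x → x < s + k → x ∷ interval s k ≈ interval s k ∷ʳ x
letter-commutes s zero s≤x x<s = contradiction (≤-<-trans s≤x x<s) (<-irrefl (sym (+-identityʳ s)))
letter-commutes {x} s (suc k) s≤x x<s+k with m≤n⇒m<n∨m≡n s≤x
... | inj₂ refl = small-letter-to-end k ≤-refl
letter-commutes {x} s (suc zero) s≤x x<s+k | inj₁ s<x =
  contradiction s<x (≤⇒≯ (m<1+n⇒m≤n (subst (x <_) (+-comm s 1) x<s+k)))
letter-commutes {x} s (suc (suc k)) s≤x x<s+k | inj₁ s<x =
  move (knuth₂ _ (n<1+n s) s<x) ⁻¹ ⨾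
  prep s (letter-commutes (suc s) (suc k) s<x (subst (x <_) (+-suc s (suc k)) x<s+k))

word-commutes : ∀ {g u} → All (_< g) u → u ++ column g ≈ column g ++ u
word-commutes {g} {[]}    []          = ≡⇒≈ (sym (++-identityʳ (column g)))
word-commutes {g} {x ∷ u} (x<g ∷ u<g) =
  prep x (word-commutes u<g) ⨾
  ++⁺ʳ (letter-commutes 0 g z≤n x<g) u ⨾
  ≡⇒≈ (++-assoc (column g) [ x ] u)

-- All letters of the shorter column occur in the longer one, which commutes with each of them.
columns-commute : ∀ h g → column h ++ column g ≈ column g ++ column h
columns-commute h g with ≤-total h g
... | inj₁ h≤g = word-commutes (All.map (λ x<h → <-≤-trans x<h h≤g) (interval-bounded 0 h))
... | inj₂ g≤h = word-commutes (All.map (λ x<g → <-≤-trans x<g g≤h) (interval-bounded 0 g)) ⁻¹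

columns : List ℕ → List ℕ
columns hs = concat (map column hs)

column-columns-commute : ∀ h gs → column h ++ columns gs ≈ columns gs ++ column h
column-columns-commute h []       = ≡⇒≈ (++-identityʳ (column h))
column-columns-commute h (g ∷ gs) =
  ≡⇒≈ (sym (++-assoc (column h) (column g) (columns gs))) ⨾
  ++⁺ʳ (columns-commute h g) (columns gs) ⨾
  ≡⇒≈ (++-assoc (column g) (column h) (columns gs)) ⨾
  ++⁺ˡ (column g) (column-columns-commute h gs) ⨾
  ≡⇒≈ (sym (++-assoc (column g) (columns gs) (column h)))

-- The same remainder `v` serves on both sides, so that turning the first form by `h` letters gives
-- exactly the second.
column-to-front : ∀ {h hs} → h ∈ˡ hs → ∃ λ v → columns hs ≈ column h ++ v × columns hs ≈ v ++ column h
column-to-front {h} {_ ∷ hs} (here refl) = columns hs , refl , column-columns-commute h hs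
column-to-front {h} {g ∷ hs} (there h∈hs) with v , front , back ← column-to-front h∈hs =
  column g ++ v ,
  (++⁺ˡ (column g) front ⨾
   ≡⇒≈ (sym (++-assoc (column g) (column h) v)) ⨾
   ++⁺ʳ (columns-commute g h) v ⨾
   ≡⇒≈ (++-assoc (column h) (column g) v)) ,
  (++⁺ˡ (column g) back ⨾ ≡⇒≈ (sym (++-assoc (column g) v (column h))))

rotate-by-column : ∀ {h hs} → h ∈ˡ hs → rotations h (columns hs) ∼ columns hs
rotate-by-column {h} {hs} h∈hs with v , front , back ← column-to-front h∈hs =
  turns h (≈⇒∼ front) ⨾
  ≡⇒∼ (trans (cong (λ k → rotations k (column h ++ v)) (sym (length-interval 0 h))) (rotations-++ (column h) v)) ⨾
  ≈⇒∼ back ⁻¹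

-- Periods of a class under rotation

Period : List ℕ → ℕ → Set
Period w k = rotations k w ∼ w

period-+ : ∀ {w j k} → Period w j → Period w k → Period w (j + k)
period-+ {w} {j} {k} p q = ≡⇒∼ (rotations-+ j k w) ⨾ turns j q ⨾ p

period-* : ∀ {w} j {k} → Period w k → Period w (j * k)
period-* zero    p = refl
period-* {w} (suc j) {k} p = period-+ {w} {k} {j * k} p (period-* j p)

period-cancel : ∀ {w} j {k} → Period w (j + k) → Period w k → Period w j
period-cancel {w} j {k} p q = turns j q ⁻¹ ⨾ ≡⇒∼ (sym (rotations-+ j k w)) ⨾ p

-- Over the naturals Bézout's identity reads `gcd j k + y * k ≡ x * j`, or the same with the roles
-- of `j` and `k` exchanged, so multiples and cancellation suffice.
period-gcd : ∀ {w} j k → Period w j → Period w k → Period w (gcd j k)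
period-gcd {w} j k p q with Bézout.identity (gcd-GCD j k)
... | Bézout.+- x y eq = period-cancel (gcd j k) (subst (Period w) (sym eq) (period-* x p)) (period-* y q)
... | Bézout.-+ x y eq = period-cancel (gcd j k) (subst (Period w) (sym eq) (period-* y q)) (period-* x p)

period-gcds : ∀ {w} ks → (∀ {k} → k ∈ˡ ks → Period w k) → Period w (foldr gcd 0 ks)
period-gcds []       p = refl
period-gcds (k ∷ ks) p = period-gcd k (foldr gcd 0 ks) (p (here refl)) (period-gcds ks (p ∘ there))

-- Rotations commute with each other, so the rotation by `i` can be brought outermost on both sides
-- and cancelled.
period-rotated : ∀ {w w'} i {k} → w ∼ rotations i w' → Period w k → Period w' k
period-rotated {w} {w'} i {k} p q = rotations-reflects-∼ i
  (≡⇒∼ (trans (sym (rotations-+ i k w')) (trans (cong (λ t → rotations t w') (+-comm i k)) (rotations-+ k i w'))) ⨾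
   turns k (p ⁻¹) ⨾ q ⨾ p)

-- Congruences

-- Multiples of `d` are allowed on both sides, so congruences can be added and cancelled without
-- subtraction and without knowing which of `a` and `b` is larger.
record Congruent (d a b : ℕ) : Set where
  constructor congruent
  field
    p q   : ℕ
    equal : a + p * d ≡ b + q * d

module _ {d : ℕ} where

  ≡⇒congruent : ∀ {a b} → a ≡ b → Congruent d a b
  ≡⇒congruent eq = congruent 0 0 (cong (_+ 0) eq)

  congruent-sym : ∀ {a b} → Congruent d a b → Congruent d b a
  congruent-sym (congruent p q eq) = congruent q p (sym eq)

  congruent-+ : ∀ {a b a' b'} → Congruent d a b → Congruent d a' b' → Congruent d (a + a') (b + b')
  congruent-+ {a} {b} {a'} {b'} (congruent p q eq) (congruent p' q' eq') = congruent (p + p') (q + q') (begin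
    (a + a') + (p + p') * d      ≡⟨ regroup a a' p p' d ⟩
    (a + p * d) + (a' + p' * d)  ≡⟨ cong₂ _+_ eq eq' ⟩
    (b + q * d) + (b' + q' * d)  ≡⟨ regroup b b' q q' d ⟨
    (b + b') + (q + q') * d      ∎)
    where
    open ≡-Reasoning
    open +-*-Solver
    regroup : ∀ a a' p p' d → (a + a') + (p + p') * d ≡ (a + p * d) + (a' + p' * d)
    regroup = solve 5 (λ a a' p p' d → (a :+ a') :+ (p :+ p') :* d := (a :+ p :* d) :+ (a' :+ p' :* d)) refl

  congruent-cancel : ∀ c {a b} → Congruent d (c + a) (c + b) → Congruent d a b
  congruent-cancel c {a} {b} (congruent p q eq) = congruent p q
    (+-cancelˡ-≡ c _ _ (trans (sym (+-assoc c a (p * d))) (trans eq (+-assoc c b (q * d)))))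

  congruent-trans : ∀ {a b c} → Congruent d a b → Congruent d b c → Congruent d a c
  congruent-trans {a} {b} {c} p q = congruent-cancel b
    (subst (λ t → Congruent d t (b + c)) (+-comm a b) (congruent-+ p q))

  -- This is what allows a term of the charge with weight divisible by `d` to take any value.
  multiple-congruent : ∀ {k} → d ∣ k → ∀ a b → Congruent d (k * a) (k * b)
  multiple-congruent {k} (divides r refl) a b = congruent (b * r) (a * r)
    (solve 4 (λ a b r d → (r :* d) :* a :+ (b :* r) :* d := (r :* d) :* b :+ (a :* r) :* d) refl a b r d)
    where open +-*-Solver

  private
    ordered-mod : ∀ {a b} → a ≤ b → Congruent d a b → d ∣ b ∸ a
    ordered-mod {a} {b} a≤b (congruent p q eq) = ∣m+n∣m⇒∣n (divides p p-eq) (n∣m*n q)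
      where
      open ≡-Reasoning
      p-eq : q * d + (b ∸ a) ≡ p * d
      p-eq = +-cancelˡ-≡ a _ _ (begin
        a + (q * d + (b ∸ a))  ≡⟨ cong (a +_) (+-comm (q * d) (b ∸ a)) ⟩
        a + ((b ∸ a) + q * d)  ≡⟨ +-assoc a (b ∸ a) (q * d) ⟨
        a + (b ∸ a) + q * d    ≡⟨ cong (_+ q * d) (m+[n∸m]≡n a≤b) ⟩
        b + q * d              ≡⟨ eq ⟨
        a + p * d              ∎)

    ordered-congruent : ∀ {a b} → a ≤ b → d ∣ b ∸ a → Congruent d a b
    ordered-congruent {a} {b} a≤b (divides r eq) = congruent r 0
      (trans (cong (a +_) (sym eq)) (trans (m+[n∸m]≡n a≤b) (sym (+-identityʳ b))))

  congruent⇒mod : ∀ {a b} → Congruent d a b → a ≡ b [mod d ]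
  congruent⇒mod {a} {b} c with ≤-total a b
  ... | inj₁ a≤b = subst (d ∣_) (sym (m≤n⇒∣m-n∣≡n∸m a≤b)) (ordered-mod a≤b c)
  ... | inj₂ b≤a = subst (d ∣_) (sym (m≤n⇒∣n-m∣≡n∸m b≤a)) (ordered-mod b≤a (congruent-sym c))

  mod⇒congruent : ∀ {a b} → a ≡ b [mod d ] → Congruent d a b
  mod⇒congruent {a} {b} m with ≤-total a b
  ... | inj₁ a≤b = ordered-congruent a≤b (subst (d ∣_) (m≤n⇒∣m-n∣≡n∸m a≤b) m)
  ... | inj₂ b≤a = congruent-sym (ordered-congruent b≤a (subst (d ∣_) (m≤n⇒∣n-m∣≡n∸m b≤a) m))

-- Bracket words and charge

data Bracket : Set where
  opening closing neutral : Bracket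

-- `c` is the number of openings still pending; the value counts the closings that meet none. This
-- is the bracketing rule of crystal operators.
unpaired : ℕ → List Bracket → ℕ
unpaired c       []             = 0
unpaired c       (opening ∷ bs) = unpaired (suc c) bs
unpaired zero    (closing ∷ bs) = suc (unpaired zero bs)
unpaired (suc c) (closing ∷ bs) = unpaired c bs
unpaired c       (neutral ∷ bs) = unpaired c bs

isOpening isClosing : Bracket → ℕ
isOpening opening = 1
isOpening _       = 0
isClosing closing = 1
isClosing _       = 0

#opening #closing : List Bracket → ℕ
#opening []       = 0
#opening (b ∷ bs) = isOpening b + #opening bs
#closing []       = 0
#closing (b ∷ bs) = isClosing b + #closing bs

unpaired-∷ʳ-opening : ∀ c bs → unpaired c (bs ∷ʳ opening) ≡ unpaired c bs
unpaired-∷ʳ-opening c       []             = refl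
unpaired-∷ʳ-opening c       (opening ∷ bs) = unpaired-∷ʳ-opening (suc c) bs
unpaired-∷ʳ-opening zero    (closing ∷ bs) = cong suc (unpaired-∷ʳ-opening zero bs)
unpaired-∷ʳ-opening (suc c) (closing ∷ bs) = unpaired-∷ʳ-opening c bs
unpaired-∷ʳ-opening c       (neutral ∷ bs) = unpaired-∷ʳ-opening c bs

unpaired-∷ʳ-neutral : ∀ c bs → unpaired c (bs ∷ʳ neutral) ≡ unpaired c bs
unpaired-∷ʳ-neutral c       []             = refl
unpaired-∷ʳ-neutral c       (opening ∷ bs) = unpaired-∷ʳ-neutral (suc c) bs
unpaired-∷ʳ-neutral zero    (closing ∷ bs) = cong suc (unpaired-∷ʳ-neutral zero bs)
unpaired-∷ʳ-neutral (suc c) (closing ∷ bs) = unpaired-∷ʳ-neutral c bs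
unpaired-∷ʳ-neutral c       (neutral ∷ bs) = unpaired-∷ʳ-neutral c bs

-- Openings, including the `c` pending ones, outnumber the closings, so one is still pending at the
-- end and takes the new closing.
unpaired-∷ʳ-closing : ∀ c bs → #closing bs < c + #opening bs → unpaired c (bs ∷ʳ closing) ≡ unpaired c bs
unpaired-∷ʳ-closing (suc c) []             _  = refl
unpaired-∷ʳ-closing c       (opening ∷ bs) lt = unpaired-∷ʳ-closing (suc c) bs (subst (#closing bs <_) (+-suc c _) lt)
unpaired-∷ʳ-closing zero    (closing ∷ bs) lt = cong suc (unpaired-∷ʳ-closing zero bs (<-trans (n<1+n _) lt))
unpaired-∷ʳ-closing (suc c) (closing ∷ bs) (s≤s lt) = unpaired-∷ʳ-closing c bs lt
unpaired-∷ʳ-closing c       (neutral ∷ bs) lt = unpaired-∷ʳ-closing c bs lt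

-- Since closings outnumber openings, some closing is unpaired, and one more pending opening absorbs
-- exactly one of these.
unpaired-suc : ∀ c bs → c + #opening bs < #closing bs → unpaired c bs ≡ suc (unpaired (suc c) bs)
unpaired-suc c       (opening ∷ bs) lt = unpaired-suc (suc c) bs (subst (_< #closing bs) (+-suc c _) lt)
unpaired-suc zero    (closing ∷ bs) _  = refl
unpaired-suc (suc c) (closing ∷ bs) (s≤s lt) = unpaired-suc c bs lt
unpaired-suc c       (neutral ∷ bs) lt = unpaired-suc c bs lt

-- With equally many brackets of both sorts, an opening moved from the front to the end leaves one
-- more closing unpaired, whereas a closing in front is unpaired and finds a pending opening at the
-- end. The two indicators stand on opposite sides to avoid subtraction.
unpaired-rotate : ∀ b bs → #opening (b ∷ bs) ≡ #closing (b ∷ bs) →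
                  unpaired 0 (bs ∷ʳ b) + isClosing b ≡ unpaired 0 (b ∷ bs) + isOpening b
unpaired-rotate opening bs eq =
  trans (+-identityʳ _) (trans (unpaired-∷ʳ-opening 0 bs)
  (trans (unpaired-suc 0 bs (≤-reflexive eq)) (+-comm 1 (unpaired 1 bs))))
unpaired-rotate closing bs eq =
  trans (cong (_+ 1) (unpaired-∷ʳ-closing 0 bs (≤-reflexive (sym eq))))
  (trans (+-comm (unpaired 0 bs) 1) (sym (+-identityʳ _)))
unpaired-rotate neutral bs eq = cong (_+ 0) (unpaired-∷ʳ-neutral 0 bs)

infix 4 _≐_

-- Quantifying over `c` makes the relation stable under brackets added in front.
_≐_ : List Bracket → List Bracket → Set
bs ≐ bs' = ∀ c → unpaired c bs ≡ unpaired c bs'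

≐-∷ : ∀ b {bs bs'} → bs ≐ bs' → b ∷ bs ≐ b ∷ bs'
≐-∷ opening eq c       = eq (suc c)
≐-∷ closing eq zero    = cong suc (eq zero)
≐-∷ closing eq (suc c) = eq c
≐-∷ neutral eq c       = eq c

neutral-commutes : ∀ b bs → b ∷ neutral ∷ bs ≐ neutral ∷ b ∷ bs
neutral-commutes opening bs c       = refl
neutral-commutes closing bs zero    = refl
neutral-commutes closing bs (suc c) = refl
neutral-commutes neutral bs c       = refl

pair-commutes-opening : ∀ bs → opening ∷ opening ∷ closing ∷ bs ≐ opening ∷ closing ∷ opening ∷ bs
pair-commutes-opening bs c = refl

pair-commutes-closing : ∀ bs → opening ∷ closing ∷ closing ∷ bs ≐ closing ∷ opening ∷ closing ∷ bs
pair-commutes-closing bs zero    = refl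
pair-commutes-closing bs (suc c) = refl

data Kind (k x : ℕ) : Bracket → Set where
  opening : x ≡ k → Kind k x opening
  closing : x ≡ suc k → Kind k x closing
  neutral : x ≢ k → x ≢ suc k → Kind k x neutral

kind : ∀ k x → ∃ (Kind k x)
kind k x with x ≟ k | x ≟ suc k
... | yes x≡k | _         = opening , opening x≡k
... | no  _   | yes x≡1+k = closing , closing x≡1+k
... | no  x≢k | no  x≢1+k = neutral , neutral x≢k x≢1+k

bracket : ℕ → ℕ → Bracket
bracket k x = proj₁ (kind k x)

brackets : ℕ → List ℕ → List Bracket
brackets k = map (bracket k)

-- Only an exchange of `k` with `k + 1` could matter. The bounds then force the third letter to be
-- `k` in front of the pair or `k + 1` behind it, and the relation just moves a complete pair past
-- an equal bracket.
brackets-invariant : ∀ k {w w'} → w ⟶ w' → brackets k w ≐ brackets k w'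
brackets-invariant k (knuth₁ {m} {a} {b} v a≤m m<b) with kind k a | kind k b
... | neutral , _ | β , _ = ≐-∷ (bracket k m) (λ c → sym (neutral-commutes β (brackets k v) c))
... | α , _ | neutral , _ = ≐-∷ (bracket k m) (neutral-commutes α (brackets k v))
... | opening , _ | opening , _ = λ _ → refl
... | closing , _ | closing , _ = λ _ → refl
... | closing , closing refl | opening , opening refl = contradiction (≤-<-trans a≤m m<b) (<-asym (n<1+n k))
... | opening , opening refl | closing , closing refl with refl ← ≤-antisym a≤m (m<1+n⇒m≤n m<b) with kind k k
... | opening , _ = pair-commutes-opening (brackets k v)
... | closing , closing k≡1+k = contradiction (sym k≡1+k) 1+n≢n
... | neutral , neutral k≢k _ = contradiction refl k≢k
brackets-invariant k (knuth₂ {a} {b} {m} v a<m m≤b) with kind k a | kind k b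
... | neutral , _ | β , _ = λ c → sym (neutral-commutes β (bracket k m ∷ brackets k v) c)
... | α , _ | neutral , _ = neutral-commutes α (bracket k m ∷ brackets k v)
... | opening , _ | opening , _ = λ _ → refl
... | closing , _ | closing , _ = λ _ → refl
... | closing , closing refl | opening , opening refl = contradiction (<-≤-trans a<m m≤b) (<-asym (n<1+n k))
... | opening , opening refl | closing , closing refl with refl ← ≤-antisym m≤b a<m with kind k (suc k)
... | opening , opening 1+k≡k = contradiction 1+k≡k 1+n≢n
... | closing , _ = pair-commutes-closing (brackets k v)
... | neutral , neutral _ 1+k≢1+k = contradiction refl 1+k≢1+k

multiplicity : ℕ → List ℕ → ℕ
multiplicity k w = length (filter (_≟ k) w)

multiplicity-∷-≡ : ∀ {k x} w → x ≡ k → multiplicity k (x ∷ w) ≡ suc (multiplicity k w)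
multiplicity-∷-≡ {k} w x≡k = cong length (filter-accept (_≟ k) x≡k)

multiplicity-∷-≢ : ∀ {k x} w → x ≢ k → multiplicity k (x ∷ w) ≡ multiplicity k w
multiplicity-∷-≢ {k} w x≢k = cong length (filter-reject (_≟ k) x≢k)

multiplicity-↭ : ∀ k {w w'} → w ↭ w' → multiplicity k w ≡ multiplicity k w'
multiplicity-↭ k p = ↭-length (filter-↭ (_≟ k) p)

#opening-brackets : ∀ k w → #opening (brackets k w) ≡ multiplicity k w
#opening-brackets k []      = refl
#opening-brackets k (x ∷ w) with kind k x
... | opening , opening x≡k   = trans (cong suc (#opening-brackets k w)) (sym (multiplicity-∷-≡ w x≡k))
... | closing , closing refl  = trans (#opening-brackets k w) (sym (multiplicity-∷-≢ w 1+n≢n))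
... | neutral , neutral x≢k _ = trans (#opening-brackets k w) (sym (multiplicity-∷-≢ w x≢k))

#closing-brackets : ∀ k w → #closing (brackets k w) ≡ multiplicity (suc k) w
#closing-brackets k []      = refl
#closing-brackets k (x ∷ w) with kind k x
... | opening , opening refl    = trans (#closing-brackets k w) (sym (multiplicity-∷-≢ w (1+n≢n ∘ sym)))
... | closing , closing x≡1+k   = trans (cong suc (#closing-brackets k w)) (sym (multiplicity-∷-≡ w x≡1+k))
... | neutral , neutral _ x≢1+k = trans (#closing-brackets k w) (sym (multiplicity-∷-≢ w x≢1+k))

Σ< : ℕ → (ℕ → ℕ) → ℕ
Σ< zero    F = 0
Σ< (suc m) F = Σ< m F + F m

Σ<-+ : ∀ m F G → Σ< m (λ k → F k + G k) ≡ Σ< m F + Σ< m G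
Σ<-+ zero    F G = refl
Σ<-+ (suc m) F G = trans (cong (_+ (F m + G m)) (Σ<-+ m F G))
  (solve 4 (λ a b c e → (a :+ b) :+ (c :+ e) := (a :+ c) :+ (b :+ e)) refl (Σ< m F) (Σ< m G) (F m) (G m))
  where open +-*-Solver

Σ<-congruent : ∀ {d} m {F G} → (∀ {k} → k < m → Congruent d (F k) (G k)) → Congruent d (Σ< m F) (Σ< m G)
Σ<-congruent zero    p = ≡⇒congruent refl
Σ<-congruent (suc m) p = congruent-+ (Σ<-congruent m (λ k<m → p (m<n⇒m<1+n k<m))) (p (n<1+n m))

Σ<-zero : ∀ m {F} → (∀ {k} → k < m → F k ≡ 0) → Σ< m F ≡ 0
Σ<-zero zero    p = refl
Σ<-zero (suc m) p = cong₂ _+_ (Σ<-zero m (λ k<m → p (m<n⇒m<1+n k<m))) (p (n<1+n m))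

Σ<-single : ∀ {j} m {F} → j < m → (∀ {k} → k ≢ j → F k ≡ 0) → Σ< m F ≡ F j
Σ<-single {j} (suc m) {F} j<1+m p with m≤n⇒m<n∨m≡n (m<1+n⇒m≤n j<1+m)
... | inj₁ j<m  = trans (cong₂ _+_ (Σ<-single m j<m p) (p (>⇒≢ j<m))) (+-identityʳ (F j))
... | inj₂ refl = cong (_+ F m) (Σ<-zero m (λ k<m → p (<⇒≢ k<m)))

-- For `m` rows this has one term more than `charge`, at `k = m - 1`: thus every letter `a < m` is
-- an opening in some term, and moving it has the same effect for all letters.
wordCharge : ℕ → List ℕ → ℕ
wordCharge m w = Σ< m (λ k → suc k * unpaired 0 (brackets k w))

bracket-opening : ∀ a → bracket a a ≡ opening
bracket-opening a with kind a a
... | opening , _               = refl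
... | closing , closing a≡1+a   = contradiction (sym a≡1+a) 1+n≢n
... | neutral , neutral a≢a _   = contradiction refl a≢a

bracket-closing : ∀ a → bracket a (suc a) ≡ closing
bracket-closing a with kind a (suc a)
... | opening , opening 1+a≡a   = contradiction 1+a≡a 1+n≢n
... | closing , _               = refl
... | neutral , neutral _ a≢a   = contradiction refl a≢a

isOpening-≢ : ∀ {k a} → k ≢ a → isOpening (bracket k a) ≡ 0
isOpening-≢ {k} {a} k≢a with kind k a
... | opening , opening a≡k = contradiction (sym a≡k) k≢a
... | closing , _           = refl
... | neutral , _           = refl

isClosing-≢ : ∀ {k a} → suc k ≢ a → isClosing (bracket k a) ≡ 0
isClosing-≢ {k} {a} 1+k≢a with kind k a
... | opening , _             = refl
... | closing , closing a≡1+k = contradiction (sym a≡1+k) 1+k≢a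
... | neutral , _             = refl

private
  times-zero : ∀ k {x} → x ≡ 0 → k * x ≡ 0
  times-zero k refl = *-zeroʳ k

Σ<-isOpening : ∀ {a m} → a < m → Σ< m (λ k → suc k * isOpening (bracket k a)) ≡ suc a
Σ<-isOpening {a} {m} a<m =
  trans (Σ<-single m a<m (λ {k} k≢a → times-zero (suc k) (isOpening-≢ k≢a)))
  (trans (cong (λ b → suc a * isOpening b) (bracket-opening a)) (*-identityʳ (suc a)))

Σ<-isClosing : ∀ {a m} → a < m → Σ< m (λ k → suc k * isClosing (bracket k a)) ≡ a
Σ<-isClosing {zero}  {m} _   = Σ<-zero m (λ {k} _ → times-zero (suc k) (isClosing-≢ {k} {0} λ ()))
Σ<-isClosing {suc a} {m} a<m =
  trans (Σ<-single m (<-trans (n<1+n a) a<m) (λ {k} k≢a → times-zero (suc k) (isClosing-≢ (k≢a ∘ suc-injective))))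
  (trans (cong (λ b → suc a * isClosing b) (bracket-closing a)) (*-identityʳ (suc a)))

-- Makes every term of the charge predictable modulo `d` under rotation: the brackets are equally
-- many, or the weight vanishes. It depends only on the content, so it persists along `_∼_`.
record Balanced (d m : ℕ) (w : List ℕ) : Set where
  field
    letters : All (_< m) w
    balance : ∀ k → k < m → multiplicity k w ≡ multiplicity (suc k) w ⊎ d ∣ suc k

Balanced-↭ : ∀ {d m w w'} → w ↭ w' → Balanced d m w → Balanced d m w'
Balanced-↭ {d} {m} {w} {w'} p bal = record
  { letters = All-resp-↭ p letters
  ; balance = λ k k<m → subst₂ (λ x y → x ≡ y ⊎ d ∣ suc k) (multiplicity-↭ k p) (multiplicity-↭ (suc k) p) (balance k k<m) }
  where open Balanced bal

-- Moving the letter a to the end changes the number of unpaired brackets by +1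
-- for k = a and by -1 for k = a - 1, hence the charge by (a + 1) - a.
wordCharge-rotate : ∀ {d m a w} → Balanced d m (a ∷ w) → Congruent d (wordCharge m (w ∷ʳ a)) (suc (wordCharge m (a ∷ w)))
wordCharge-rotate {d} {m} {a} {w} bal = congruent-cancel a
  (subst₂ (Congruent d) lhs rhs (Σ<-congruent m {F} {G} term))
  where
  open Balanced bal
  open ≡-Reasoning
  F G : ℕ → ℕ
  F k = suc k * unpaired 0 (brackets k (w ∷ʳ a)) + suc k * isClosing (bracket k a)
  G k = suc k * unpaired 0 (brackets k (a ∷ w)) + suc k * isOpening (bracket k a)
  term : ∀ {k} → k < m → Congruent d (F k) (G k)
  term {k} k<m with balance k k<m
  -- The weight `suc k` vanishes modulo `d`, so both sides do, whatever the brackets are.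
  ... | inj₂ d∣1+k = congruent-+ {a = suc k * unpaired 0 (brackets k (w ∷ʳ a))} {b = suc k * unpaired 0 (brackets k (a ∷ w))}
    (multiple-congruent d∣1+k (unpaired 0 (brackets k (w ∷ʳ a))) (unpaired 0 (brackets k (a ∷ w))))
    (multiple-congruent d∣1+k (isClosing (bracket k a)) (isOpening (bracket k a)))
  ... | inj₁ same = ≡⇒congruent (begin
    F k
      ≡⟨ *-distribˡ-+ (suc k) (unpaired 0 (brackets k (w ∷ʳ a))) (isClosing (bracket k a)) ⟨
    suc k * (unpaired 0 (brackets k (w ∷ʳ a)) + isClosing (bracket k a))
      ≡⟨ cong (λ bs → suc k * (unpaired 0 bs + isClosing (bracket k a))) (map-++ (bracket k) w [ a ]) ⟩
    suc k * (unpaired 0 (brackets k w ∷ʳ bracket k a) + isClosing (bracket k a))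
      ≡⟨ cong (suc k *_) (unpaired-rotate (bracket k a) (brackets k w)
           (trans (#opening-brackets k (a ∷ w)) (trans same (sym (#closing-brackets k (a ∷ w)))))) ⟩
    suc k * (unpaired 0 (brackets k (a ∷ w)) + isOpening (bracket k a))
      ≡⟨ *-distribˡ-+ (suc k) (unpaired 0 (brackets k (a ∷ w))) (isOpening (bracket k a)) ⟩
    G k ∎)
  a<m : a < m
  a<m = All.head letters
  lhs : Σ< m F ≡ a + wordCharge m (w ∷ʳ a)
  lhs = trans (Σ<-+ m (λ k → suc k * unpaired 0 (brackets k (w ∷ʳ a))) (λ k → suc k * isClosing (bracket k a)))
    (trans (cong (wordCharge m (w ∷ʳ a) +_) (Σ<-isClosing a<m)) (+-comm _ a))
  rhs : Σ< m G ≡ a + suc (wordCharge m (a ∷ w))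
  rhs = trans (Σ<-+ m (λ k → suc k * unpaired 0 (brackets k (a ∷ w))) (λ k → suc k * isOpening (bracket k a)))
    (trans (cong (wordCharge m (a ∷ w) +_) (Σ<-isOpening a<m))
    (trans (+-comm _ (suc a)) (sym (+-suc a _))))

wordCharge-rotations : ∀ {d m a w} j → Balanced d m (a ∷ w) →
                       Congruent d (wordCharge m (rotations j (a ∷ w))) (j + wordCharge m (a ∷ w))
wordCharge-rotations zero bal = ≡⇒congruent refl
wordCharge-rotations {a = a} {w} (suc j) bal with rotations j (a ∷ w) | rotations-↭ j (a ∷ w) | wordCharge-rotations j bal
... | []    | p | ih = contradiction (↭-length p) λ ()
... | _ ∷ _ | p | ih = congruent-trans (wordCharge-rotate (Balanced-↭ (↭-sym p) bal)) (congruent-+ (≡⇒congruent {a = 1} refl) ih)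

wordCharge-⟶ : ∀ {w w'} m → w ⟶ w' → wordCharge m w ≡ wordCharge m w'
wordCharge-⟶ zero    p = refl
wordCharge-⟶ (suc m) p = cong₂ _+_ (wordCharge-⟶ m p) (cong (suc m *_) (brackets-invariant m p 0))

-- Plactic moves preserve the charge exactly. A turn raises the charges of both words by 1 modulo
-- `d`, which keeps them congruent.
wordCharge-∼ : ∀ {d m w w'} → w ∼ w' → Balanced d m w → Congruent d (wordCharge m w) (wordCharge m w')
wordCharge-∼ {m = m} (move p) bal = ≡⇒congruent (wordCharge-⟶ m p)
wordCharge-∼ refl     bal = ≡⇒congruent refl
wordCharge-∼ (p ⁻¹)   bal = congruent-sym (wordCharge-∼ p (Balanced-↭ (↭-sym (∼⇒↭ p)) bal))
wordCharge-∼ (p ⨾ q)  bal = congruent-trans (wordCharge-∼ p bal) (wordCharge-∼ q (Balanced-↭ (∼⇒↭ p) bal))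
wordCharge-∼ (turn {[]} {w'} p) bal with refl ← ↭-empty-inv (↭-sym (∼⇒↭ p)) = ≡⇒congruent refl
wordCharge-∼ (turn {_ ∷ _} {[]} p) bal with () ← ↭-empty-inv (∼⇒↭ p)
wordCharge-∼ (turn {a ∷ w} {a' ∷ w'} p) bal = congruent-trans (wordCharge-rotate bal')
  (congruent-trans (congruent-+ (≡⇒congruent {a = 1} refl) (wordCharge-∼ p bal'))
    (congruent-sym (wordCharge-rotate (Balanced-↭ (∼⇒↭ p) bal'))))
  where bal' = Balanced-↭ (rotate-↭ (a ∷ w)) bal

multiplicity-++ : ∀ k u v → multiplicity k (u ++ v) ≡ multiplicity k u + multiplicity k v
multiplicity-++ k u v = trans (cong length (filter-++ (_≟ k) u v)) (length-++ (filter (_≟ k) u))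

multiplicity⇒∈ : ∀ {k} w → 0 < multiplicity k w → k ∈ˡ w
multiplicity⇒∈ {k} (x ∷ w) pos with x ≟ k
... | yes refl = here refl
... | no  x≢k  = there (multiplicity⇒∈ w (subst (0 <_) (multiplicity-∷-≢ w x≢k) pos))

multiplicities⇒↭ : ∀ w w' → (∀ k → multiplicity k w ≡ multiplicity k w') → w ↭ w'
multiplicities⇒↭ []      []       same = ↭-refl
multiplicities⇒↭ []      (x ∷ w') same = contradiction (trans (same x) (multiplicity-∷-≡ {x} w' refl)) λ ()
multiplicities⇒↭ (x ∷ w) w'       same
  with u , v , refl ← ∈-∃++ (multiplicity⇒∈ {x} w' (subst (0 <_) (trans (sym (multiplicity-∷-≡ {x} w refl)) (same x)) (s≤s z≤n))) =
  ↭-trans (prep x (multiplicities⇒↭ w (u ++ v) same')) (↭-sym (shift x u v))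
  where
  same'' : ∀ k → multiplicity k (x ∷ w) ≡ multiplicity k (x ∷ u ++ v)
  same'' k = trans (same k) (multiplicity-↭ k (shift x u v))
  same' : ∀ k → multiplicity k w ≡ multiplicity k (u ++ v)
  same' k with x ≟ k
  ... | yes x≡k = suc-injective (trans (sym (multiplicity-∷-≡ w x≡k)) (trans (same'' k) (multiplicity-∷-≡ (u ++ v) x≡k)))
  ... | no  x≢k = trans (sym (multiplicity-∷-≢ w x≢k)) (trans (same'' k) (multiplicity-∷-≢ (u ++ v) x≢k))

-- Conjugate partitions

-- Reads 0 beyond the end of the list.
entry : List ℕ → ℕ → ℕ
entry []       _       = 0
entry (p ∷ ps) zero    = p
entry (p ∷ ps) (suc k) = entry ps k

height : List ℕ → ℕ → ℕ
height ps j = length (filter (suc j ≤?_) ps)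

entry-≤ : ∀ {b} ps → All (_≤ b) ps → ∀ k → entry ps k ≤ b
entry-≤ []       []           k       = z≤n
entry-≤ (p ∷ ps) (p≤b ∷ ps≤b) zero    = p≤b
entry-≤ (p ∷ ps) (p≤b ∷ ps≤b) (suc k) = entry-≤ ps ps≤b k

entry-decreasing : ∀ {ps} → Decreasing ps → ∀ k → entry ps (suc k) ≤ entry ps k
entry-decreasing []                  k       = z≤n
entry-decreasing {_ ∷ ps} (ps≤p ∷ _) zero    = entry-≤ ps ps≤p 0
entry-decreasing (_ ∷ ps↘)           (suc k) = entry-decreasing ps↘ k

height-small : ∀ {p j} ps → All (_≤ p) ps → p ≤ j → height ps j ≡ 0
height-small {j = j} ps ps≤p p≤j =
  cong length (filter-none (suc j ≤?_) (All.map (λ q≤p → ≤⇒≯ (≤-trans q≤p p≤j)) ps≤p))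

height-∷-< : ∀ {p j} ps → j < p → height (p ∷ ps) j ≡ suc (height ps j)
height-∷-< {j = j} ps j<p = cong length (filter-accept (suc j ≤?_) {xs = ps} j<p)

-- With its converse below, the duality between a partition and its conjugate: both inequalities say
-- that the diagram has a cell in row `k` and column `j`.
<height⇒<entry : ∀ {ps} → Decreasing ps → ∀ j k → k < height ps j → j < entry ps k
<height⇒<entry {p ∷ ps} (ps≤p ∷ ps↘) j k k<h with j <? p
... | no j≮p = contradiction (subst (k <_) (height-small (p ∷ ps) (≤-refl ∷ ps≤p) (≮⇒≥ j≮p)) k<h) n≮0
<height⇒<entry {p ∷ ps} (ps≤p ∷ ps↘) j zero    k<h | yes j<p = j<p
<height⇒<entry {p ∷ ps} (ps≤p ∷ ps↘) j (suc k) k<h | yes j<p =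
  <height⇒<entry ps↘ j k (m<1+n⇒m≤n (subst (suc k <_) (height-∷-< ps j<p) k<h))

<entry⇒<height : ∀ {ps} → Decreasing ps → ∀ j k → j < entry ps k → k < height ps j
<entry⇒<height {[]}     []           j k       j<e = contradiction j<e n≮0
<entry⇒<height {p ∷ ps} (ps≤p ∷ ps↘) j zero    j<e = subst (0 <_) (sym (height-∷-< ps j<e)) (s≤s z≤n)
<entry⇒<height {p ∷ ps} (ps≤p ∷ ps↘) j (suc k) j<e =
  subst (suc k <_) (sym (height-∷-< ps (<-≤-trans j<e (entry-≤ ps ps≤p k)))) (s≤s (<entry⇒<height ps↘ j k j<e))

heights : List ℕ → List ℕ
heights ps = map (height ps) (upTo (max 0 ps))

height∈heights : ∀ {ps} j k → j < entry ps k → height ps j ∈ˡ heights ps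
height∈heights {ps} j k j<e = ∈-map⁺ (height ps) (∈-upTo⁺ (<-≤-trans j<e (entry-≤ ps (xs≤max 0 ps) k)))

-- The last column meeting row `k` does not reach row `k + 1`, so its height is `k + 1`. This is the
-- source of all divisibility by `d`.
height-at-descent : ∀ {ps} → Decreasing ps → ∀ k → entry ps k ≢ entry ps (suc k) → suc k ∈ˡ heights ps
height-at-descent {ps} ps↘ k ≢ with entry ps k in eq
... | zero  = contradiction (sym (n≤0⇒n≡0 (subst (entry ps (suc k) ≤_) eq (entry-decreasing ps↘ k)))) ≢
... | suc j = subst (_∈ˡ heights ps) (≤-antisym upper-bound lower-bound) (height∈heights {ps} j k j<e)
  where
  j<e : j < entry ps k
  j<e = subst (j <_) (sym eq) (n<1+n j)
  lower-bound : suc k ≤ height ps j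
  lower-bound = <entry⇒<height ps↘ j k j<e
  upper-bound : height ps j ≤ suc k
  upper-bound = ≮⇒≥ λ k<h → ≢ (≤-antisym (<height⇒<entry ps↘ j (suc k) k<h)
    (subst (entry ps (suc k) ≤_) eq (entry-decreasing ps↘ k)))

gcds-divide : ∀ {k} ks → k ∈ˡ ks → foldr gcd 0 ks ∣ k
gcds-divide (k ∷ ks) (here refl)  = gcd[m,n]∣m k (foldr gcd 0 ks)
gcds-divide (k ∷ ks) (there j∈ks) = ∣-trans (gcd[m,n]∣n k (foldr gcd 0 ks)) (gcds-divide ks j∈ks)

multiplicity-interval-< : ∀ {k} s h → k < s → multiplicity k (interval s h) ≡ 0
multiplicity-interval-< s zero    k<s = refl
multiplicity-interval-< s (suc h) k<s =
  trans (multiplicity-∷-≢ (interval (suc s) h) (>⇒≢ k<s)) (multiplicity-interval-< (suc s) h (m<n⇒m<1+n k<s))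

multiplicity-interval-∈ : ∀ {k} s h → s ≤ k → k < s + h → multiplicity k (interval s h) ≡ 1
multiplicity-interval-∈ {k} s zero s≤k k<s+h = contradiction (subst (k <_) (+-identityʳ s) k<s+h) (≤⇒≯ s≤k)
multiplicity-interval-∈ {k} s (suc h) s≤k k<s+h with m≤n⇒m<n∨m≡n s≤k
... | inj₁ s<k  = trans (multiplicity-∷-≢ (interval (suc s) h) (<⇒≢ s<k))
                        (multiplicity-interval-∈ (suc s) h s<k (subst (k <_) (+-suc s h) k<s+h))
... | inj₂ refl = trans (multiplicity-∷-≡ {s} (interval (suc s) h) refl)
                        (cong suc (multiplicity-interval-< (suc s) h (n<1+n s)))

multiplicity-column-≥ : ∀ {k} h → h ≤ k → multiplicity k (column h) ≡ 0
multiplicity-column-≥ {k} h h≤k =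
  cong length (filter-none (_≟ k) (All.map (λ x<h → <⇒≢ (<-≤-trans x<h h≤k)) (interval-bounded 0 h)))

multiplicity-columns : ∀ k hs → multiplicity k (columns hs) ≡ length (filter (suc k ≤?_) hs)
multiplicity-columns k []       = refl
multiplicity-columns k (h ∷ hs) with k <? h
... | yes k<h = trans (multiplicity-++ k (column h) (columns hs))
  (trans (cong₂ _+_ (multiplicity-interval-∈ 0 h z≤n k<h) (multiplicity-columns k hs))
         (cong length (sym (filter-accept (suc k ≤?_) {xs = hs} k<h))))
... | no  k≮h = trans (multiplicity-++ k (column h) (columns hs))
  (trans (cong₂ _+_ (multiplicity-column-≥ h (≮⇒≥ k≮h)) (multiplicity-columns k hs))
         (cong length (sym (filter-reject (suc k ≤?_) {xs = hs} k≮h))))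

length-filter-map : ∀ {A B : Set} {P : Pred B 0ℓ} (P? : Decidable P) (f : A → B) xs →
                    length (filter P? (map f xs)) ≡ length (filter (P? ∘ f) xs)
length-filter-map P? f []       = refl
length-filter-map P? f (x ∷ xs) with does (P? (f x))
... | true  = cong suc (length-filter-map P? f xs)
... | false = length-filter-map P? f xs

length-filter-<-upTo : ∀ {c} M → c ≤ M → length (filter (_<? c) (upTo M)) ≡ c
length-filter-<-upTo zero    z≤n = refl
length-filter-<-upTo {c} (suc M) c≤1+M with m≤n⇒m<n∨m≡n c≤1+M
... | inj₂ refl = trans (cong length (filter-all (_<? suc M) (all-upTo (suc M)))) (length-upTo (suc M))
... | inj₁ c<1+M = begin
  length (filter (_<? c) (upTo (suc M)))                    ≡⟨ cong (length ∘ filter (_<? c)) (upTo-∷ʳ M) ⟨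
  length (filter (_<? c) (upTo M ∷ʳ M))                     ≡⟨ cong length (filter-++ (_<? c) (upTo M) [ M ]) ⟩
  length (filter (_<? c) (upTo M) ++ filter (_<? c) [ M ])  ≡⟨ length-++ (filter (_<? c) (upTo M)) ⟩
  length (filter (_<? c) (upTo M)) + length (filter (_<? c) [ M ])
    ≡⟨ cong₂ _+_ (length-filter-<-upTo M c≤M) (cong length (filter-reject (_<? c) {xs = []} (≤⇒≯ c≤M))) ⟩
  c + 0                                                     ≡⟨ +-identityʳ c ⟩
  c                                                         ∎
  where
  open ≡-Reasoning
  c≤M = m<1+n⇒m≤n c<1+M

-- Conjugating twice returns `ps`: the letter `k` occurs once in each column of height above `k`,
-- and by duality these are the columns `j < entry ps k`.
multiplicity-columns-heights : ∀ {ps} → Decreasing ps → ∀ k → multiplicity k (columns (heights ps)) ≡ entry ps k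
multiplicity-columns-heights {ps} ps↘ k = begin
  multiplicity k (columns (heights ps))                              ≡⟨ multiplicity-columns k (heights ps) ⟩
  length (filter (suc k ≤?_) (heights ps))                           ≡⟨ length-filter-map (suc k ≤?_) (height ps) (upTo (max 0 ps)) ⟩
  length (filter (λ j → suc k ≤? height ps j) (upTo (max 0 ps)))
    ≡⟨ cong length (filter-≐ (λ j → suc k ≤? height ps j) (_<? entry ps k)
         ((λ {j} → <height⇒<entry ps↘ j k) , (λ {j} → <entry⇒<height ps↘ j k)) (upTo (max 0 ps))) ⟩
  length (filter (_<? entry ps k) (upTo (max 0 ps)))                 ≡⟨ length-filter-<-upTo (max 0 ps) (entry-≤ ps (xs≤max 0 ps) k) ⟩
  entry ps k                                                         ∎
  where open ≡-Reasoning

-- Equivalence classes of words with a given content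

HasContent : List ℕ → List ℕ → Set
HasContent ps w = ∀ k → multiplicity k w ≡ entry ps k

entry-length : ∀ {ps} k → length ps ≤ k → entry ps k ≡ 0
entry-length {[]}     k       _        = refl
entry-length {_ ∷ ps} (suc k) (s≤s le) = entry-length {ps} k le

content⇒letters : ∀ {ps w} → HasContent ps w → All (_< length ps) w
content⇒letters {ps} {w} content = All.tabulate λ {x} x∈w → ≰⇒> λ ℓ≤x →
  contradiction (trans (content x) (entry-length {ps} x ℓ≤x)) (>⇒≢ (∈⇒multiplicity w x∈w))
  where
  ∈⇒multiplicity : ∀ {k} w → k ∈ˡ w → 0 < multiplicity k w
  ∈⇒multiplicity {k} (x ∷ w) (here refl) = subst (0 <_) (sym (multiplicity-∷-≡ {k} w refl)) (s≤s z≤n)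
  ∈⇒multiplicity {k} (x ∷ w) (there k∈w) with x ≟ k
  ... | yes x≡k = subst (0 <_) (sym (multiplicity-∷-≡ w x≡k)) (s≤s z≤n)
  ... | no  x≢k = subst (0 <_) (sym (multiplicity-∷-≢ w x≢k)) (∈⇒multiplicity w k∈w)

content⇒balanced : ∀ {ps w} → Decreasing ps → HasContent ps w → Balanced (foldr gcd 0 (heights ps)) (length ps) w
content⇒balanced {ps} {w} ps↘ content = record
  { letters = content⇒letters {ps} content
  ; balance = λ k _ → balance k }
  where
  balance : ∀ k → multiplicity k w ≡ multiplicity (suc k) w ⊎ foldr gcd 0 (heights ps) ∣ suc k
  balance k with entry ps k ≟ entry ps (suc k)
  ... | yes same = inj₁ (trans (content k) (trans same (sym (content (suc k)))))
  ... | no  ≢    = inj₂ (gcds-divide (heights ps) (height-at-descent ps↘ k ≢))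

decreasing-unique : ∀ {D E} → Decreasing D → Decreasing E → D ↭ E → D ≡ E
decreasing-unique {[]}    {E}     D↘ E↘ p = sym (↭-empty-inv (↭-sym p))
decreasing-unique {x ∷ D} {[]}    D↘ E↘ p = ↭-empty-inv p
decreasing-unique {x ∷ D} {y ∷ E} (D≤x ∷ D↘) (E≤y ∷ E↘) p
  with refl ← ≤-antisym (All.lookup (≤-refl ∷ E≤y) (∈-resp-↭ p (here refl)))
                        (All.lookup (≤-refl ∷ D≤x) (∈-resp-↭ (↭-sym p) (here refl))) =
  cong (x ∷_) (decreasing-unique D↘ E↘ (drop-∷ p))

rotated-rows : ∀ {w w'} → w ↭ w' → ∃ λ D → Decreasing D × (∃ λ i → w ∼ rotations i D) × (∃ λ j → w' ∼ rotations j D)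
rotated-rows {w} {w'} w↭w' with rotated-row w | rotated-row w'
... | i , D , D↘ , p | j , E , E↘ , q
  with refl ← decreasing-unique D↘ E↘
    (↭-trans (↭-sym (↭-trans (∼⇒↭ p) (rotations-↭ i D))) (↭-trans w↭w' (↭-trans (∼⇒↭ q) (rotations-↭ j E)))) =
  D , D↘ , (i , p) , (j , q)

-- The word of columns is equivalent to a rotation of some decreasing word; that word has the
-- content of `D`, hence is `D`, and so inherits the periods.
row-period : ∀ {ps D} → Decreasing ps → HasContent ps D → Decreasing D → Period D (foldr gcd 0 (heights ps))
row-period {ps} {D} ps↘ content D↘ with rotated-row (columns (heights ps))
... | i , E , E↘ , p with refl ← decreasing-unique D↘ E↘
    (↭-trans (multiplicities⇒↭ D (columns (heights ps)) (λ k → trans (content k) (sym (multiplicity-columns-heights ps↘ k))))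
             (↭-trans (∼⇒↭ p) (rotations-↭ i E))) =
  period-gcds (heights ps) (λ {k} k∈ → period-rotated i {k} p (rotate-by-column k∈))

rotations-congruent : ∀ {w d i j} → Period w d → Congruent d i j → rotations i w ∼ rotations j w
rotations-congruent {w} {d} {i} {j} period (congruent p q eq) =
  turns i (period-* p period) ⁻¹ ⨾
  ≡⇒∼ (trans (sym (rotations-+ i (p * d) w)) (trans (cong (λ k → rotations k w) eq) (rotations-+ j (q * d) w))) ⨾
  turns j (period-* q period)

content-↭ : ∀ {ps w w'} → w ↭ w' → HasContent ps w → HasContent ps w'
content-↭ p content k = trans (sym (multiplicity-↭ k p)) (content k)

connected⇔congruent : ∀ {ps w w'} → Decreasing ps → HasContent ps w → HasContent ps w' →
  w ∼ w' ⇔ Congruent (foldr gcd 0 (heights ps)) (wordCharge (length ps) w) (wordCharge (length ps) w')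
connected⇔congruent {ps} {w} {w'} ps↘ content content' =
  mk⇔ (λ p → wordCharge-∼ p (content⇒balanced ps↘ content)) connect
  where
  g = foldr gcd 0 (heights ps)
  ch = wordCharge (length ps)
  connect : Congruent g (ch w) (ch w') → w ∼ w'
  connect c with rotated-rows (multiplicities⇒↭ w w' (λ k → trans (content k) (sym (content' k))))
  -- The empty word is its own only rotation; the charge formula for rotations requires a first
  -- letter.
  ... | [] , _ , (i , p) , (j , q) =
    p ⨾ ≡⇒∼ (trans (↭-empty-inv (rotations-↭ i [])) (sym (↭-empty-inv (rotations-↭ j [])))) ⨾ q ⁻¹
  ... | D@(_ ∷ _) , D↘ , (i , p) , (j , q) =
    p ⨾ rotations-congruent (row-period ps↘ content-D D↘) i≡j ⨾ q ⁻¹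
    where
    content-D : HasContent ps D
    content-D = content-↭ {ps} (↭-trans (∼⇒↭ p) (rotations-↭ i D)) content
    charge-of : ∀ {v} k → HasContent ps v → v ∼ rotations k D → Congruent g (ch v) (k + ch D)
    charge-of k content-v r = congruent-trans (wordCharge-∼ r (content⇒balanced ps↘ content-v))
      (wordCharge-rotations k (content⇒balanced ps↘ content-D))
    -- The two charges are `i + ch D` and `j + ch D` modulo `g`, so their congruence is that of the
    -- rotation amounts.
    i≡j : Congruent g i j
    i≡j = congruent-cancel (ch D) (subst₂ (Congruent g) (+-comm i (ch D)) (+-comm j (ch D))
      (congruent-trans (congruent-sym (charge-of i content p)) (congruent-trans c (charge-of j content' q))))

-- Greedy matching

module _ {A : Set} {P Q : Pred A 0ℓ} (P? : Decidable P) (Q? : Decidable Q) where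

  filter-filter : ∀ xs → filter P? (filter Q? xs) ≡ filter (λ x → P? x ×-dec Q? x) xs
  filter-filter [] = refl
  filter-filter (x ∷ xs) with does (Q? x) | does (P? x) in p
  ... | false | false           = filter-filter xs
  ... | false | true            = filter-filter xs
  ... | true  | false rewrite p = filter-filter xs
  ... | true  | true  rewrite p = cong (x ∷_) (filter-filter xs)

module _ {A : Set} {P Q : Pred A 0ℓ} (P? : Decidable P) (Q? : Decidable Q) where

  filter-comm : ∀ xs → filter P? (filter Q? xs) ≡ filter Q? (filter P? xs)
  filter-comm xs = trans (filter-filter P? Q? xs)
    (trans (filter-≐ (λ x → P? x ×-dec Q? x) (λ x → Q? x ×-dec P? x) ((λ (p , q) → q , p) , (λ (q , p) → p , q)) xs)
           (sym (filter-filter Q? P? xs)))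

  filter-absorb : (∀ {x} → P x → Q x) → ∀ xs → filter P? (filter Q? xs) ≡ filter P? xs
  filter-absorb P⊆Q xs = trans (filter-filter P? Q? xs)
    (filter-≐ (λ x → P? x ×-dec Q? x) P? (proj₁ , (λ p → p , P⊆Q p)) xs)

uncons : ∀ {A : Set} (xs : List A) → xs ≡ [] ⊎ ∃₂ λ y ys → xs ≡ y ∷ ys
uncons []       = inj₁ refl
uncons (y ∷ ys) = inj₂ (y , ys , refl)

∈-difference⇒∉ : ∀ {n} (p q : Subset n) {x} → x ∈ p ─ q → x ∉ q
∈-difference⇒∉ (inside ∷ p) (outside ∷ q) here       ()
∈-difference⇒∉ (_ ∷ p)      (outside ∷ q) (there x∈) (there x∈q) = ∈-difference⇒∉ p q x∈ x∈q
∈-difference⇒∉ (_ ∷ p)      (inside ∷ q)  (there x∈) (there x∈q) = ∈-difference⇒∉ p q x∈ x∈q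

module _ {n : ℕ} where

  Increasing : List (Fin n) → Set
  Increasing = AllPairs Fin._<_

  allFin-increasing : Increasing (allFin n)
  allFin-increasing = AllPairs.tabulate⁺-< id

  elements-increasing : ∀ (U : Subset n) → Increasing (elements U)
  elements-increasing U = AllPairs.filter⁺ (_∈? U) allFin-increasing

  ∈elements⇒∈ : ∀ {x} {U : Subset n} → x ∈ˡ elements U → x ∈ U
  ∈elements⇒∈ {U = U} x∈ = proj₂ (∈-filter⁻ (_∈? U) {xs = allFin n} x∈)

  ≢? : ∀ (b : Fin n) → Decidable (_≢ b)
  ≢? b x = ¬? (x Fin.≟ b)

  ∈-minus⇒≢ : ∀ {x b} (U : Subset n) → x ∈ U - b → x ≢ b
  ∈-minus⇒≢ {b = b} U x∈ refl = ∈-difference⇒∉ U ⁅ b ⁆ x∈ (x∈⁅x⁆ b)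

  elements-minus : ∀ (U : Subset n) b → elements (U - b) ≡ filter (≢? b) (elements U)
  elements-minus U b = sym (trans (filter-filter (≢? b) (_∈? U) (allFin n))
    (filter-≐ (λ x → ≢? b x ×-dec (x ∈? U)) (_∈? (U - b))
      ((λ (x≢b , x∈U) → x∈p∧x≢y⇒x∈p-y x∈U x≢b) , (λ x∈ → ∈-minus⇒≢ U x∈ , p─q⊆p U ⁅ b ⁆ x∈)) (allFin n)))

  length-filter-≢ : ∀ b {xs} → Increasing xs → length xs ≤ suc (length (filter (≢? b) xs))
  length-filter-≢ b {[]}     []           = z≤n
  length-filter-≢ b {x ∷ xs} (x<xs ∷ xs↗) with x Fin.≟ b
  ... | yes refl = s≤s (≤-reflexive (cong length (sym (filter-all (≢? b) (All.map (λ b<y y≡b → Fin.<⇒≢ b<y (sym y≡b)) x<xs)))))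
  ... | no  x≢b  = s≤s (length-filter-≢ b xs↗)

  -- The number of as that are matched to a larger element: later elements of
  -- the increasing list as cannot use the elements of bs skipped here.
  greedy : List (Fin n) → List (Fin n) → ℕ
  greedy []       bs = 0
  greedy (a ∷ as) bs with filter (a Fin.<?_) bs
  ... | []      = 0
  ... | _ ∷ bs' = suc (greedy as bs')

  greedy-[] : ∀ as → greedy as [] ≡ 0
  greedy-[] []      = refl
  greedy-[] (_ ∷ _) = refl

  greedy-fail : ∀ {a} as bs → filter (a Fin.<?_) bs ≡ [] → greedy (a ∷ as) bs ≡ 0
  greedy-fail {a} as bs eq with filter (a Fin.<?_) bs | eq
  ... | .[] | refl = refl

  greedy-match : ∀ {a b bs'} as bs → filter (a Fin.<?_) bs ≡ b ∷ bs' → greedy (a ∷ as) bs ≡ suc (greedy as bs')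
  greedy-match {a} as bs eq with filter (a Fin.<?_) bs | eq
  ... | .(_ ∷ _) | refl = refl

  descents-matching : ∀ (a : Fin n) as U b → partner a U ≡ just b →
                      descents (matching (a ∷ as) U) ≡ descents ((a , b) ∷ matching as (U - b))
  descents-matching a as U b eq with partner a U | eq
  ... | .(just b) | refl = refl

  descents-∷-< : ∀ (a b : Fin n) ps → b Fin.< a → descents ((a , b) ∷ ps) ≡ suc (descents ps)
  descents-∷-< a b ps b<a = cong length
    (filter-accept {P = λ (a , b) → b Fin.< a} (λ (a , b) → b Fin.<? a) {x = a , b} {xs = ps} b<a)

  descents-∷-≮ : ∀ (a b : Fin n) ps → ¬ b Fin.< a → descents ((a , b) ∷ ps) ≡ descents ps
  descents-∷-≮ a b ps b≮a = cong length
    (filter-reject {P = λ (a , b) → b Fin.< a} (λ (a , b) → b Fin.<? a) {x = a , b} {xs = ps} b≮a)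

  -- Maintains the link between `U` and the list standing for it in `descents+greedy`: for a later
  -- `a'` only elements above `a` count, and there deleting `b` leaves `bs'`.
  filter-after-match : ∀ {a a' b} U → a Fin.< a' → ∀ {bs'} →
    filter (≢? b) (filter (a Fin.<?_) (elements U)) ≡ bs' →
    filter (a' Fin.<?_) (elements (U - b)) ≡ filter (a' Fin.<?_) bs'
  filter-after-match {a} {a'} {b} U a<a' {bs'} eq = begin
    filter (a' Fin.<?_) (elements (U - b))
      ≡⟨ cong (filter (a' Fin.<?_)) (elements-minus U b) ⟩
    filter (a' Fin.<?_) (filter (≢? b) (elements U))
      ≡⟨ filter-absorb (a' Fin.<?_) (a Fin.<?_) (Fin.<-trans a<a') (filter (≢? b) (elements U)) ⟨
    filter (a' Fin.<?_) (filter (a Fin.<?_) (filter (≢? b) (elements U)))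
      ≡⟨ cong (filter (a' Fin.<?_)) (filter-comm (a Fin.<?_) (≢? b) (elements U)) ⟩
    filter (a' Fin.<?_) (filter (≢? b) (filter (a Fin.<?_) (elements U)))
      ≡⟨ cong (filter (a' Fin.<?_)) eq ⟩
    filter (a' Fin.<?_) bs' ∎
    where open ≡-Reasoning

  -- The list bs stands for U, of which only the elements larger than some
  -- element of as matter.
  descents+greedy : ∀ as U bs → Increasing as → All (_∉ U) as → length as ≤ length (elements U) →
    All (λ a → filter (a Fin.<?_) (elements U) ≡ filter (a Fin.<?_) bs) as →
    descents (matching as U) + greedy as bs ≡ length as
  descents+greedy []       U bs _ _ _ _ = refl
  descents+greedy (a ∷ as) U bs (a<as ∷ as↗) (a∉U ∷ as∉U) len (eq ∷ eqs)
    with uncons (filter (a Fin.<?_) (elements U))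
  ... | inj₂ (b , bs' , filtered) = begin
    descents (matching (a ∷ as) U) + greedy (a ∷ as) bs
      ≡⟨ cong₂ _+_ (descents-matching a as U b (cong (λ xs → head xs <∣> head (elements U)) filtered))
                   (greedy-match as bs (trans (sym eq) filtered)) ⟩
    descents ((a , b) ∷ matching as (U - b)) + suc (greedy as bs')
      ≡⟨ cong (_+ suc (greedy as bs')) (descents-∷-≮ a b (matching as (U - b)) (Fin.<-asym a<b)) ⟩
    descents (matching as (U - b)) + suc (greedy as bs')
      ≡⟨ +-suc (descents (matching as (U - b))) (greedy as bs') ⟩
    suc (descents (matching as (U - b)) + greedy as bs')
      ≡⟨ cong suc (descents+greedy as (U - b) bs' as↗
           (All.map (λ x∉U → x∉U ∘ p─q⊆p U ⁅ b ⁆) as∉U) (remaining b)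
           (All.map (λ a<a' → filter-after-match U a<a' without-b) a<as)) ⟩
    suc (length as) ∎
    where
    open ≡-Reasoning
    sorted : Increasing (b ∷ bs')
    sorted = subst Increasing filtered (AllPairs.filter⁺ (a Fin.<?_) (elements-increasing U))
    a<b : a Fin.< b
    a<b = proj₂ (∈-filter⁻ (a Fin.<?_) {xs = elements U} (subst (b ∈ˡ_) (sym filtered) (here refl)))
    without-b : filter (≢? b) (filter (a Fin.<?_) (elements U)) ≡ bs'
    without-b = trans (cong (filter (≢? b)) filtered)
      (trans (filter-reject (≢? b) (λ b≢b → b≢b refl))
             (filter-all (≢? b) (All.map (λ b<y y≡b → Fin.<⇒≢ b<y (sym y≡b)) (AllPairs.head sorted))))
    remaining : ∀ b → length as ≤ length (elements (U - b))
    remaining b = subst (length as ≤_) (cong length (sym (elements-minus U b)))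
      (≤-pred (≤-trans len (length-filter-≢ b (elements-increasing U))))
  -- No element of `U` exceeds `a`, hence none exceeds the later, larger elements: the match wraps
  -- around, `greedy` has ended, and from here on `[]` stands for `U`.
  ... | inj₁ filtered with uncons (elements U)
  ...   | inj₁ empty = contradiction (≤-trans len (≤-reflexive (cong length empty))) λ ()
  ...   | inj₂ (b , bs' , all-elements) = begin
    descents (matching (a ∷ as) U) + greedy (a ∷ as) bs
      ≡⟨ cong₂ _+_ (descents-matching a as U b partner≡) (greedy-fail as bs (trans (sym eq) filtered)) ⟩
    descents ((a , b) ∷ matching as (U - b)) + 0
      ≡⟨ cong (_+ 0) (descents-∷-< a b (matching as (U - b)) b<a) ⟩
    suc (descents (matching as (U - b)) + 0)
      ≡⟨ cong (λ g → suc (descents (matching as (U - b)) + g)) (greedy-[] as) ⟨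
    suc (descents (matching as (U - b)) + greedy as [])
      ≡⟨ cong suc (descents+greedy as (U - b) [] as↗
           (All.map (λ x∉U → x∉U ∘ p─q⊆p U ⁅ b ⁆) as∉U) remaining
           (All.map (λ a<a' → filter-after-match U a<a' nothing-left) a<as)) ⟩
    suc (length as) ∎
    where
    open ≡-Reasoning
    partner≡ : partner a U ≡ just b
    partner≡ = cong₂ (λ xs ys → head xs <∣> head ys) filtered all-elements
    b∈ : b ∈ˡ elements U
    b∈ = subst (b ∈ˡ_) (sym all-elements) (here refl)
    nothing-left : filter (≢? b) (filter (a Fin.<?_) (elements U)) ≡ []
    nothing-left = cong (filter (≢? b)) filtered
    b<a : b Fin.< a
    b<a with Fin.<-cmp b a
    ... | tri< b<a _ _ = b<a
    ... | tri≈ _ refl _ = contradiction (∈elements⇒∈ b∈) a∉U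
    ... | tri> _ _ a<b with () ← subst (b ∈ˡ_) filtered (∈-filter⁺ (a Fin.<?_) b∈ a<b)
    remaining : length as ≤ length (elements (U - b))
    remaining = subst (length as ≤_) (cong length (sym (elements-minus U b)))
      (≤-pred (≤-trans len (length-filter-≢ b (elements-increasing U))))

  greedy-skip : ∀ {x} as bs → All (x Fin.<_) as → greedy as (x ∷ bs) ≡ greedy as bs
  greedy-skip []       bs _         = refl
  greedy-skip {x} (a ∷ as) bs (x<a ∷ _) with uncons (filter (a Fin.<?_) bs)
  ... | inj₁ eq           = trans (greedy-fail as (x ∷ bs) (trans (filter-reject (a Fin.<?_) (Fin.<-asym x<a)) eq))
                                  (sym (greedy-fail as bs eq))
  ... | inj₂ (_ , _ , eq) = trans (greedy-match as (x ∷ bs) (trans (filter-reject (a Fin.<?_) (Fin.<-asym x<a)) eq))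
                                  (sym (greedy-match as bs eq))

  -- The list as holds the unmatched openings met before xs.
  greedy+unpaired : ∀ k (f : Fin n → ℕ) as xs → Increasing xs → All (λ a → All (a Fin.<_) xs) as →
    greedy (as ++ filter (λ x → f x ≟ k) xs) (filter (λ x → f x ≟ suc k) xs)
      + unpaired (length as) (brackets k (map f xs))
    ≡ length (filter (λ x → f x ≟ suc k) xs)
  greedy+unpaired k f as [] _ _ = cong (_+ 0) (greedy-[] (as ++ []))
  greedy+unpaired k f as (x ∷ xs) (x<xs ∷ xs↗) as< with kind k (f x)
  ... | neutral , neutral ≢k ≢1+k
    rewrite filter-reject (λ x → f x ≟ k) {xs = xs} ≢k | filter-reject (λ x → f x ≟ suc k) {xs = xs} ≢1+k =
    greedy+unpaired k f as xs xs↗ (All.map All.tail as<)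
  ... | opening , opening ≡k
    rewrite filter-accept (λ x → f x ≟ k) {xs = xs} ≡k
          | filter-reject (λ x → f x ≟ suc k) {xs = xs} (λ ≡1+k → 1+n≢n (trans (sym ≡1+k) ≡k)) =
    trans (cong₂ (λ bs c → greedy bs (filter (λ x → f x ≟ suc k) xs) + unpaired c (brackets k (map f xs)))
            (sym (++-assoc as [ x ] (filter (λ x → f x ≟ k) xs))) (sym (trans (length-++ as) (+-comm (length as) 1))))
      (greedy+unpaired k f (as ∷ʳ x) xs xs↗ (++⁺ (All.map All.tail as<) (x<xs ∷ [])))
  greedy+unpaired k f [] (x ∷ xs) (x<xs ∷ xs↗) as< | closing , closing ≡1+k
    rewrite filter-reject (λ x → f x ≟ k) {xs = xs} (λ ≡k → 1+n≢n (trans (sym ≡1+k) ≡k))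
          | filter-accept (λ x → f x ≟ suc k) {xs = xs} ≡1+k =
    trans (cong (_+ _) (greedy-skip (filter (λ x → f x ≟ k) xs) _ (All.filter⁺ (λ x → f x ≟ k) x<xs)))
      (trans (+-suc _ _) (cong suc (greedy+unpaired k f [] xs xs↗ [])))
  -- The greedy matching gives `x` to the oldest pending opening, whereas brackets usually pair with
  -- the latest; the number of pairs is the same.
  greedy+unpaired k f (a ∷ as) (x ∷ xs) (x<xs ∷ xs↗) ((a<x ∷ a<xs) ∷ as<) | closing , closing ≡1+k
    rewrite filter-reject (λ x → f x ≟ k) {xs = xs} (λ ≡k → 1+n≢n (trans (sym ≡1+k) ≡k))
          | filter-accept (λ x → f x ≟ suc k) {xs = xs} ≡1+k =
    trans (cong (_+ _) (greedy-match (as ++ filter (λ x → f x ≟ k) xs) (x ∷ filter (λ x → f x ≟ suc k) xs)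
            (filter-all (a Fin.<?_) (a<x ∷ All.filter⁺ (λ x → f x ≟ suc k) a<xs))))
      (cong suc (greedy+unpaired k f as xs xs↗ (All.map All.tail as<)))

  -- Both numbers complement the same number of upward matches, the descents within `A` and the
  -- unpaired closings within `B`, and the two rows have equal size.
  descents≡unpaired : ∀ k (f : Fin n → ℕ) A B →
    elements A ≡ filter (λ x → f x ≟ k) (allFin n) → elements B ≡ filter (λ x → f x ≟ suc k) (allFin n) →
    length (elements A) ≡ length (elements B) →
    descents (matching (elements A) B) ≡ unpaired 0 (brackets k (map f (allFin n)))
  descents≡unpaired k f A B A≡ B≡ sizes = +-cancelʳ-≡ (greedy (elements A) (elements B)) _ _ (begin
    descents (matching (elements A) B) + greedy (elements A) (elements B)
      ≡⟨ descents+greedy (elements A) B (elements B) (elements-increasing A) disjoint (≤-reflexive sizes) (All.tabulate (λ _ → refl)) ⟩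
    length (elements A)
      ≡⟨ trans sizes (cong length B≡) ⟩
    length (filter (λ x → f x ≟ suc k) (allFin n))
      ≡⟨ greedy+unpaired k f [] (allFin n) allFin-increasing [] ⟨
    greedy (filter (λ x → f x ≟ k) (allFin n)) (filter (λ x → f x ≟ suc k) (allFin n)) + unpaired 0 (brackets k (map f (allFin n)))
      ≡⟨ cong (_+ unpaired 0 (brackets k (map f (allFin n)))) (cong₂ greedy A≡ B≡) ⟨
    greedy (elements A) (elements B) + unpaired 0 (brackets k (map f (allFin n)))
      ≡⟨ +-comm (greedy (elements A) (elements B)) _ ⟩
    unpaired 0 (brackets k (map f (allFin n))) + greedy (elements A) (elements B) ∎)
    where
    open ≡-Reasoning
    disjoint : All (_∉ B) (elements A)
    disjoint = All.tabulate λ {x} x∈A x∈B → 1+n≢n (trans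
      (sym (proj₂ (∈-filter⁻ (λ x → f x ≟ suc k) {xs = allFin n} (subst (x ∈ˡ_) B≡ (∈-filter⁺ (_∈? B) (∈-allFin x) x∈B)))))
      (proj₂ (∈-filter⁻ (λ x → f x ≟ k) {xs = allFin n} (subst (x ∈ˡ_) A≡ x∈A))))

-- Words of tabloids

length-elements : ∀ {n} (p : Subset n) → length (elements p) ≡ ∣ p ∣
length-elements []      = refl
length-elements (s ∷ p) = first s
  where
  later : ∀ s → length (filter (_∈? (s ∷ p)) (tabulate Fin.suc)) ≡ ∣ p ∣
  later s = trans (cong (length ∘ filter (_∈? (s ∷ p))) (sym (map-tabulate id Fin.suc)))
    (trans (length-filter-map (_∈? (s ∷ p)) Fin.suc (allFin _))
    (trans (cong length (filter-≐ (λ x → Fin.suc x ∈? (s ∷ p)) (_∈? p) (drop-there , there) (allFin _))) (length-elements p)))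
  first : ∀ s → length (elements (s ∷ p)) ≡ ∣ s ∷ p ∣
  first true  = cong suc (later inside)
  first false = later outside

module _ {n : ℕ} {lam : Partition n} where

  -- The row is found by a search over the finitely many rows; the irrelevant field `covering` only
  -- certifies that the search succeeds.
  row-of : (T : Tabloid lam) → ∀ x → ∃ λ r → x ∈ row T r
  row-of T@(record { covering = covering }) x = recompute (any? (λ r → x ∈? row T r)) (covering x)

  row-unique : (T : Tabloid lam) → ∀ {x r s} → x ∈ row T r → x ∈ row T s → r ≡ s
  row-unique T@(record { disjoint = disjoint }) {x} {r} {s} x∈r x∈s with r Fin.≟ s
  ... | yes r≡s = r≡s
  ... | no  r≢s = ⊥-elim-irr (disjoint r s r≢s (x , x∈p∩q⁺ (x∈r , x∈s)))

  row-size : (T : Tabloid lam) → ∀ r → ∣ row T r ∣ ≡ part lam r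
  row-size T@(record { sizes = sizes }) r = recompute (∣ row T r ∣ ≟ part lam r) (sizes r)

  letter : Tabloid lam → Fin n → ℕ
  letter T x = toℕ (proj₁ (row-of T x))

  word : Tabloid lam → List ℕ
  word T = tabulate (letter T)

  ∈row⇒letter : ∀ T {x r} → x ∈ row T r → letter T x ≡ toℕ r
  ∈row⇒letter T {x} x∈r = cong toℕ (row-unique T (proj₂ (row-of T x)) x∈r)

  letter⇒∈row : ∀ T {x r} → letter T x ≡ toℕ r → x ∈ row T r
  letter⇒∈row T {x} eq = subst (λ s → x ∈ row T s) (toℕ-injective eq) (proj₂ (row-of T x))

  tabloid-≡ : ∀ {T T' : Tabloid lam} → rows T ≡ rows T' → T ≡ T'
  tabloid-≡ {record { rows = _ }} {record { rows = _ }} refl = refl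

  letters-≡⇒≡ : ∀ {T T' : Tabloid lam} → (∀ x → letter T x ≡ letter T' x) → T ≡ T'
  letters-≡⇒≡ {T} {T'} same = tabloid-≡
    (trans (sym (tabulate∘lookup (rows T))) (trans (Vec.tabulate-cong λ r → ⊆-antisym
      (λ {x} x∈ → letter⇒∈row T' (trans (sym (same x)) (∈row⇒letter T x∈)))
      (λ {x} x∈ → letter⇒∈row T (trans (same x) (∈row⇒letter T' x∈)))) (tabulate∘lookup (rows T'))))

  elements-row : ∀ T r → elements (row T r) ≡ filter (λ x → letter T x ≟ toℕ r) (allFin n)
  elements-row T r = filter-≐ (_∈? row T r) (λ x → letter T x ≟ toℕ r) (∈row⇒letter T , letter⇒∈row T) (allFin n)

entry-lookup : ∀ ps i → lookup ps i ≡ entry ps (toℕ i)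
entry-lookup (p ∷ ps) zero    = refl
entry-lookup (p ∷ ps) (suc i) = entry-lookup ps i

tabulate-injective : ∀ {A : Set} {n} {f g : Fin n → A} → tabulate f ≡ tabulate g → ∀ x → f x ≡ g x
tabulate-injective {n = suc n} eq zero    = ∷-injectiveˡ eq
tabulate-injective {n = suc n} eq (suc x) = tabulate-injective (∷-injectiveʳ eq) x

multiplicity-tabulate : ∀ {n} k (f : Fin n → ℕ) → multiplicity k (tabulate f) ≡ length (filter (λ x → f x ≟ k) (allFin n))
multiplicity-tabulate {n} k f =
  trans (cong (multiplicity k) (sym (map-tabulate id f))) (length-filter-map (_≟ k) f (allFin n))

module _ {n : ℕ} {lam : Partition n} where

  word-content : (T : Tabloid lam) → HasContent (parts lam) (word T)
  word-content T k with k <? #parts lam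
  ... | yes k<ℓ = begin
    multiplicity k (word T)                               ≡⟨ multiplicity-tabulate k (letter T) ⟩
    length (filter (λ x → letter T x ≟ k) (allFin n))     ≡⟨ cong (λ k → length (filter (λ x → letter T x ≟ k) (allFin n))) (toℕ-fromℕ< k<ℓ) ⟨
    length (filter (λ x → letter T x ≟ toℕ r) (allFin n)) ≡⟨ cong length (elements-row T r) ⟨
    length (elements (row T r))                           ≡⟨ length-elements (row T r) ⟩
    ∣ row T r ∣                                           ≡⟨ row-size T r ⟩
    part lam r                                            ≡⟨ entry-lookup (parts lam) r ⟩
    entry (parts lam) (toℕ r)                             ≡⟨ cong (entry (parts lam)) (toℕ-fromℕ< k<ℓ) ⟩
    entry (parts lam) k                                   ∎
    where
    open ≡-Reasoning
    r = fromℕ< k<ℓ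
  ... | no k≮ℓ = trans
    (cong length (filter-none (_≟ k) (tabulate⁺ λ x → <⇒≢ (<-≤-trans (toℕ<n (proj₁ (row-of T x))) (≮⇒≥ k≮ℓ)))))
    (sym (entry-length {parts lam} k (≮⇒≥ k≮ℓ)))

  module _ (f : Fin n → ℕ) (content : HasContent (parts lam) (tabulate f)) where

    private
      R : Fin (#parts lam) → Subset n
      R r = Vec.tabulate (λ x → does (f x ≟ toℕ r))

      all-rows : Vec.Vec (Subset n) (#parts lam)
      all-rows = Vec.tabulate R

      in-row : ∀ {x r} → f x ≡ toℕ r → x ∈ Vec.lookup all-rows r
      in-row {x} {r} eq = subst (x ∈_) (sym (lookup∘tabulate R r))
        (lookup⇒[]= x (R r) (trans (lookup∘tabulate _ x) (dec-true (f x ≟ toℕ r) eq)))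

      from-row : ∀ {x r} → x ∈ Vec.lookup all-rows r → f x ≡ toℕ r
      from-row {x} {r} x∈ with f x ≟ toℕ r
      ... | yes eq = eq
      ... | no  ≢  = contradiction
        (trans (sym (dec-false (f x ≟ toℕ r) ≢)) (trans (sym (lookup∘tabulate _ x)) ([]=⇒lookup (subst (x ∈_) (lookup∘tabulate R r) x∈))))
        λ ()

      bounded : ∀ x → f x < #parts lam
      bounded = tabulate⁻ (content⇒letters {parts lam} content)

    fromLetters : Tabloid lam
    fromLetters = record
      { rows     = all-rows
      ; disjoint = λ r s r≢s (x , x∈) → let (x∈r , x∈s) = x∈p∩q⁻ _ _ x∈ in
          r≢s (toℕ-injective (trans (sym (from-row x∈r)) (from-row x∈s)))
      ; sizes    = λ r → trans (sym (length-elements (Vec.lookup all-rows r)))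
          (trans (cong length (filter-≐ (_∈? Vec.lookup all-rows r) (λ x → f x ≟ toℕ r) (from-row , in-row) (allFin n)))
          (trans (sym (multiplicity-tabulate (toℕ r) f))
          (trans (content (toℕ r)) (sym (entry-lookup (parts lam) r)))))
      ; covering = λ x → fromℕ< (bounded x) , in-row (sym (toℕ-fromℕ< (bounded x)))
      }

    letter-fromLetters : ∀ x → letter fromLetters x ≡ f x
    letter-fromLetters x = sym (from-row (proj₂ (row-of fromLetters x)))

-- Lets the intermediate words of a chain of equivalences be read as tabloids of the same shape.
realise : ∀ {n} (lam : Partition n) w → length w ≡ n → HasContent (parts lam) w → ∃ λ (T : Tabloid lam) → word T ≡ w
realise lam w refl content =
  fromLetters (lookup w) content' ,
  trans (tabulate-cong (letter-fromLetters {lam = lam} (lookup w) content')) (tabulate-lookup w)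
  where
  content' : HasContent (parts lam) (tabulate (lookup w))
  content' = subst (HasContent (parts lam)) (sym (tabulate-lookup w)) content

-- The charge of a tabloid and the charge of its word

toℕ-upper : ∀ {ℓ} (k : Fin (pred ℓ)) → toℕ (upper {ℓ} k) ≡ toℕ k
toℕ-upper {suc ℓ} k = toℕ-inject₁ k

toℕ-lower : ∀ {ℓ} (k : Fin (pred ℓ)) → toℕ (lower {ℓ} k) ≡ suc (toℕ k)
toℕ-lower {suc ℓ} k = refl

Σ<-front : ∀ m (F : ℕ → ℕ) → Σ< (suc m) F ≡ F 0 + Σ< m (F ∘ suc)
Σ<-front zero    F = +-comm 0 (F 0)
Σ<-front (suc m) F = trans (cong (_+ F (suc m)) (Σ<-front m F)) (+-assoc (F 0) _ _)

sum-tabulate : ∀ {d m} (G : Fin m → ℕ) (F : ℕ → ℕ) → (∀ k → Congruent d (G k) (F (toℕ k))) → Congruent d (sum (tabulate G)) (Σ< m F)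
sum-tabulate {m = zero}  G F p = ≡⇒congruent refl
sum-tabulate {d} {suc m} G F p = subst (Congruent d _) (sym (Σ<-front m F))
  (congruent-+ (p zero) (sum-tabulate (G ∘ suc) (F ∘ suc) (p ∘ suc)))

parts-decreasing : ∀ {n} (lam : Partition n) → Decreasing (parts lam)
parts-decreasing lam = Linked⇒AllPairs (λ y≤x z≤y → ≤-trans z≤y y≤x) (Partition.decreasing lam)

module _ {n : ℕ} {lam : Partition n} where

  d∣-at-descent : ∀ k → entry (parts lam) k ≢ entry (parts lam) (suc k) → d lam ∣ suc k
  d∣-at-descent k ≢ = gcds-divide (conjugate lam) (height-at-descent (parts-decreasing lam) k ≢)

  lch-equal : ∀ (T : Tabloid lam) k → part lam (upper k) ≡ part lam (lower k) → lch T k ≡ unpaired 0 (brackets (toℕ k) (word T))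
  lch-equal T k eq = begin
    lch T k
      ≡⟨ cong (if_then descents (matching (elements (row T (upper k))) (row T (lower k))) else 0) (dec-true (part lam (upper k) ≟ part lam (lower k)) eq) ⟩
    descents (matching (elements (row T (upper k))) (row T (lower k)))
      ≡⟨ descents≡unpaired (toℕ k) (letter T) (row T (upper k)) (row T (lower k))
           (trans (elements-row T (upper k)) (cong (λ j → filter (λ x → letter T x ≟ j) (allFin n)) (toℕ-upper {#parts lam} k)))
           (trans (elements-row T (lower k)) (cong (λ j → filter (λ x → letter T x ≟ j) (allFin n)) (toℕ-lower {#parts lam} k)))
           (trans (length-elements (row T (upper k))) (trans (row-size T (upper k)) (trans eq
             (trans (sym (row-size T (lower k))) (sym (length-elements (row T (lower k)))))))) ⟩
    unpaired 0 (brackets (toℕ k) (map (letter T) (allFin n)))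
      ≡⟨ cong (unpaired 0 ∘ brackets (toℕ k)) (map-tabulate id (letter T)) ⟩
    unpaired 0 (brackets (toℕ k) (word T)) ∎
    where open ≡-Reasoning

  -- For rows of different sizes the bracket count may be positive while `lch` is 0, but there the
  -- weight is divisible by `d`.
  lch-congruent : ∀ (T : Tabloid lam) k → Congruent (d lam) (suc (toℕ k) * lch T k) (suc (toℕ k) * unpaired 0 (brackets (toℕ k) (word T)))
  lch-congruent T k with part lam (upper k) ≟ part lam (lower k)
  ... | yes eq = ≡⇒congruent (cong (suc (toℕ k) *_) (lch-equal T k eq))
  ... | no  ≢  = multiple-congruent (d∣-at-descent (toℕ k) λ eq → ≢ (begin
    part lam (upper k)               ≡⟨ entry-lookup (parts lam) (upper k) ⟩
    entry (parts lam) (toℕ (upper k)) ≡⟨ cong (entry (parts lam)) (toℕ-upper {#parts lam} k) ⟩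
    entry (parts lam) (toℕ k)        ≡⟨ eq ⟩
    entry (parts lam) (suc (toℕ k))  ≡⟨ cong (entry (parts lam)) (toℕ-lower {#parts lam} k) ⟨
    entry (parts lam) (toℕ (lower k)) ≡⟨ entry-lookup (parts lam) (lower k) ⟨
    part lam (lower k) ∎)) _ _
    where open ≡-Reasoning

last-entry : ∀ p ps → All NonZero (p ∷ ps) → entry (p ∷ ps) (length ps) ≢ 0
last-entry p []       (p≢0 ∷ _)   refl = NonZero.nonZero p≢0
last-entry p (q ∷ ps) (_ ∷ qs≢0)  eq   = last-entry q ps qs≢0 eq

-- The last part is positive and `entry` reads 0 after it. This is a descent, so the weight of the
-- extra term, which is the number of parts, is divisible by `d`.
last-term : ∀ {n} (lam : Partition n) (F : ℕ → ℕ) →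
  Congruent (d lam) (Σ< (pred (#parts lam)) (λ k → suc k * F k)) (Σ< (#parts lam) (λ k → suc k * F k))
last-term {n} lam F = go (parts lam) refl
  where
  go : ∀ ps → parts lam ≡ ps → Congruent (d lam) (Σ< (pred (length ps)) (λ k → suc k * F k)) (Σ< (length ps) (λ k → suc k * F k))
  go []       _  = ≡⇒congruent refl
  go (p ∷ ps) eq = congruent-trans (≡⇒congruent (sym (+-identityʳ (Σ< (length ps) (λ k → suc k * F k)))))
    (congruent-+ (≡⇒congruent refl)
      (congruent-trans (≡⇒congruent (sym (*-zeroʳ (suc (length ps)))))
        (multiple-congruent (d∣-at-descent {lam = lam} (length ps) (subst (λ qs → entry qs (length ps) ≢ entry qs (suc (length ps))) (sym eq)
          λ same → last-entry p ps (subst (All NonZero) eq (Partition.positive lam))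
            (trans same (entry-length {p ∷ ps} (suc (length ps)) ≤-refl)))) 0 (F (length ps)))))

charge-word : ∀ {n} {lam : Partition n} (T : Tabloid lam) → Congruent (d lam) (charge T) (wordCharge (#parts lam) (word T))
charge-word {lam = lam} T = congruent-trans
  (≡⇒congruent (cong sum (map-tabulate id (λ k → suc (toℕ k) * lch T k))))
  (congruent-trans
    (sum-tabulate (λ k → suc (toℕ k) * lch T k) (λ k → suc k * unpaired 0 (brackets k (word T))) (lch-congruent T))
    (last-term lam (λ k → unpaired 0 (brackets k (word T)))))

-- Cyclic positions

module _ {m : ℕ} where

  toℕ-next : (x : Fin (suc m)) → toℕ (next x) ≡ suc (toℕ x) % suc m
  toℕ-next x = toℕ-fromℕ< (m%n<n (suc (toℕ x)) (suc m))

  next-inject₁ : (x : Fin m) → next (inject₁ x) ≡ suc x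
  next-inject₁ x = toℕ-injective (trans (toℕ-next (inject₁ x))
    (trans (cong (λ j → suc j % suc m) (toℕ-inject₁ x)) (m<n⇒m%n≡m (s≤s (toℕ<n x)))))

  next-fromℕ : next (fromℕ m) ≡ zero
  next-fromℕ = toℕ-injective (trans (toℕ-next (fromℕ m)) (trans (cong (λ j → suc j % suc m) (toℕ-fromℕ m)) (n%n≡0 (suc m))))

  nexts : ℕ → Fin (suc m) → Fin (suc m)
  nexts zero    x = x
  nexts (suc k) x = next (nexts k x)

  nexts-next : ∀ k x → nexts k (next x) ≡ next (nexts k x)
  nexts-next zero    x = refl
  nexts-next (suc k) x = cong next (nexts-next k x)

  toℕ-nexts-zero : ∀ k → k < suc m → toℕ (nexts k zero) ≡ k
  toℕ-nexts-zero zero    _   = refl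
  toℕ-nexts-zero (suc k) k<n = trans (toℕ-next (nexts k zero))
    (trans (cong (λ j → suc j % suc m) (toℕ-nexts-zero k (<-trans (n<1+n k) k<n))) (m<n⇒m%n≡m k<n))

  nexts-zero : ∀ x → nexts (toℕ x) zero ≡ x
  nexts-zero x = toℕ-injective (toℕ-nexts-zero (toℕ x) (toℕ<n x))

rotations-multiple : ∀ {A : Set} k (w : List A) → rotations (k * length w) w ≡ w
rotations-multiple zero    w = refl
rotations-multiple (suc k) w = trans (rotations-+ (length w) (k * length w) w)
  (trans (cong (rotations (length w)) (rotations-multiple k w)) (rotations-length w))

tabulate-∷ʳ : ∀ {A : Set} {m} (f : Fin (suc m) → A) → tabulate f ≡ tabulate (f ∘ inject₁) ∷ʳ f (fromℕ m)
tabulate-∷ʳ {m = zero}  f = refl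
tabulate-∷ʳ {m = suc m} f = cong (f zero ∷_) (tabulate-∷ʳ (f ∘ suc))

module _ {m : ℕ} {A : Set} where

  tabulate-next : (f : Fin (suc m) → A) → tabulate (f ∘ next) ≡ rotate (tabulate f)
  tabulate-next f = trans (tabulate-∷ʳ (f ∘ next))
    (cong₂ _∷ʳ_ (tabulate-cong (cong f ∘ next-inject₁)) (cong f next-fromℕ))

  tabulate-nexts : ∀ k (f : Fin (suc m) → A) → tabulate (f ∘ nexts k) ≡ rotations k (tabulate f)
  tabulate-nexts zero    f = refl
  tabulate-nexts (suc k) f = trans (tabulate-nexts k (f ∘ next))
    (trans (cong (rotations k) (tabulate-next f)) (rotations-rotate k (tabulate f)))

module _ {m : ℕ} where

  -- Read off from the word of all positions, which a rotation by its length returns to itself.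
  nexts-period : (x : Fin (suc m)) → nexts (suc m) x ≡ x
  nexts-period = tabulate-injective (trans (tabulate-nexts (suc m) id)
    (trans (cong (λ k → rotations k (tabulate id)) (sym (length-tabulate {n = suc m} id))) (rotations-length (tabulate id))))

  prev : Fin (suc m) → Fin (suc m)
  prev = nexts m

  next-prev : ∀ x → next (prev x) ≡ x
  next-prev = nexts-period

  next-injective : ∀ {x y} → next x ≡ next y → x ≡ y
  next-injective {x} {y} eq = trans (sym (back x)) (trans (cong prev eq) (back y))
    where
    back : ∀ x → prev (next x) ≡ x
    back x = trans (nexts-next m x) (nexts-period x)

  nexts-injective : ∀ k {x y} → nexts k x ≡ nexts k y → x ≡ y
  nexts-injective zero    eq = eq
  nexts-injective (suc k) eq = nexts-injective k (next-injective eq)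

  nexts-surjective : ∀ k y → ∃ λ x → nexts k x ≡ y
  nexts-surjective zero    y = y , refl
  nexts-surjective (suc k) y with x , eq ← nexts-surjective k (prev y) = x , trans (cong next eq) (next-prev y)

-- Exchanges of two letters

record Swapped {n : ℕ} (i j : Fin n) (f f' : Fin n → ℕ) : Set where
  constructor swapped
  field
    first  : f' i ≡ f j
    second : f' j ≡ f i
    others : ∀ {x} → x ≢ i → x ≢ j → f' x ≡ f x

swapped-sym : ∀ {n} {i j : Fin n} {f f'} → Swapped i j f f' → Swapped i j f' f
swapped-sym (swapped p q r) = swapped (sym q) (sym p) (λ x≢i x≢j → sym (r x≢i x≢j))

transpose-first : ∀ {n} (i j : Fin n) → transpose i j i ≡ j
transpose-first i j rewrite dec-true (i Fin.≟ i) refl = refl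

transpose-second : ∀ {n} (i j : Fin n) → transpose i j j ≡ i
transpose-second i j with j Fin.≟ i
... | yes j≡i = j≡i
... | no  _ rewrite dec-true (j Fin.≟ j) refl = refl

transpose-other : ∀ {n} {i j x : Fin n} → x ≢ i → x ≢ j → transpose i j x ≡ x
transpose-other {i = i} {j} {x} x≢i x≢j rewrite dec-false (x Fin.≟ i) x≢i | dec-false (x Fin.≟ j) x≢j = refl

swapped-transpose : ∀ {n} {i j : Fin n} {f f'} → (∀ x → f' x ≡ f (transpose i j x)) → Swapped i j f f'
swapped-transpose {i = i} {j} {f} eq = swapped
  (trans (eq i) (cong f (transpose-first i j)))
  (trans (eq j) (cong f (transpose-second i j)))
  (λ x≢i x≢j → trans (eq _) (cong f (transpose-other x≢i x≢j)))

transpose-swapped : ∀ {n} {i j : Fin n} {f f'} → Swapped i j f f' → ∀ x → f' x ≡ f (transpose i j x)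
transpose-swapped {i = i} {j} {f} {f'} (swapped p q r) x = by-cases (x Fin.≟ i) (x Fin.≟ j)
  where
  by-cases : Dec (x ≡ i) → Dec (x ≡ j) → f' x ≡ f (transpose i j x)
  by-cases (yes refl) _          = trans p (cong f (sym (transpose-first i j)))
  by-cases (no _)     (yes refl) = trans q (cong f (sym (transpose-second i j)))
  by-cases (no x≢i)   (no x≢j)   = trans (r x≢i x≢j) (cong f (sym (transpose-other x≢i x≢j)))

module _ {m : ℕ} where

  swapped-nexts⁺ : ∀ k {i j : Fin (suc m)} {f f'} → Swapped (nexts k i) (nexts k j) f f' → Swapped i j (f ∘ nexts k) (f' ∘ nexts k)
  swapped-nexts⁺ k (swapped p q r) =
    swapped p q (λ x≢i x≢j → r (x≢i ∘ nexts-injective k) (x≢j ∘ nexts-injective k))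

  swapped-nexts⁻ : ∀ k {i j : Fin (suc m)} {f f'} → Swapped i j (f ∘ nexts k) (f' ∘ nexts k) → Swapped (nexts k i) (nexts k j) f f'
  swapped-nexts⁻ k {i} {j} {f} {f'} (swapped p q r) = swapped p q others
    where
    others : ∀ {y} → y ≢ nexts k i → y ≢ nexts k j → f' y ≡ f y
    others {y} y≢i y≢j with x , refl ← nexts-surjective k y = r (y≢i ∘ cong (nexts k)) (y≢j ∘ cong (nexts k))

-- Ascents and plactic relations on the circle

Ascent : ∀ {m} → (Fin (suc m) → ℕ) → Fin (suc m) → Set
Ascent f x = f x < f (next x)

-- `knuth₁` and `knuth₂` at the three positions starting from `p` or `i`. In both, `f` has an ascent
-- at the exchanged pair, which `f'` loses.
data Step {m : ℕ} (f f' : Fin (suc m) → ℕ) : Set where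
  step₁ : ∀ p → Swapped (next p) (next (next p)) f f' → f (next p) ≤ f p → f p < f (next (next p)) → Step f f'
  step₂ : ∀ i → Swapped i (next i) f f' → f i < f (next (next i)) → f (next (next i)) ≤ f (next i) → Step f f'

module _ {m : ℕ} where

  private
    N : ℕ
    N = suc (suc (suc m))


  next-≢ : ∀ (x : Fin N) → next x ≢ x
  next-≢ x eq with () ← nexts-injective (toℕ x) {1F} {0F}
    (trans (nexts-next (toℕ x) 0F) (trans (cong next (nexts-zero x)) (trans eq (sym (nexts-zero x)))))

  -- Here three positions are essential: on a circle of two, the position after a pair is the first
  -- of the pair again. A rotation carries the claim to `0F`, where it is evident.
  next²-≢ : ∀ (x : Fin N) → next (next x) ≢ x
  next²-≢ x eq with () ← nexts-injective (toℕ x) {2F} {0F}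
    (trans (nexts-next (toℕ x) 1F) (trans (cong next (nexts-next (toℕ x) 0F))
      (trans (cong (next ∘ next) (nexts-zero x)) (trans eq (sym (nexts-zero x))))))

  head-move₁ : ∀ {g g' : Fin N → ℕ} → Swapped 1F 2F g g' → g 1F ≤ g 0F → g 0F < g 2F → tabulate g ⟶ tabulate g'
  head-move₁ {g} {g'} (swapped p q r) a≤m m<b
    rewrite p | q | r {0F} (λ ()) (λ ()) | tabulate-cong {f = λ x → g' (suc (suc (suc x)))} (λ x → r {suc (suc (suc x))} (λ ()) (λ ())) =
    knuth₁ _ a≤m m<b

  head-move₂ : ∀ {g g' : Fin N → ℕ} → Swapped 0F 1F g g' → g 0F < g 2F → g 2F ≤ g 1F → tabulate g ⟶ tabulate g'
  head-move₂ {g} {g'} (swapped p q r) a<m m≤b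
    rewrite p | q | r {2F} (λ ()) (λ ()) | tabulate-cong {f = λ x → g' (suc (suc (suc x)))} (λ x → r {suc (suc (suc x))} (λ ()) (λ ())) =
    knuth₂ _ a<m m≤b

  base : ∀ (x : Fin N) → nexts (toℕ x) 0F ≡ x × nexts (toℕ x) 1F ≡ next x × nexts (toℕ x) 2F ≡ next (next x)
  base x = nexts-zero x , one , trans (nexts-next (toℕ x) 1F) (cong next one)
    where
    one : nexts (toℕ x) 1F ≡ next x
    one = trans (nexts-next (toℕ x) 0F) (cong next (nexts-zero x))

  rotated-move : ∀ k {f f' : Fin N → ℕ} → tabulate (f ∘ nexts k) ⟶ tabulate (f' ∘ nexts k) → tabulate f ∼ tabulate f'
  rotated-move k {f} {f'} mv =
    rotations-reflects-∼ k (subst₂ _∼_ (tabulate-nexts k f) (tabulate-nexts k f') (move mv))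

  step⇒∼ : ∀ {f f' : Fin N → ℕ} → Step f f' → tabulate f ∼ tabulate f'
  step⇒∼ {f} {f'} (step₁ p sw a≤m m<b) with e₀ , e₁ , e₂ ← base p = rotated-move (toℕ p) {f} {f'}
    (head-move₁ (swapped-nexts⁺ (toℕ p) (subst₂ (λ i j → Swapped i j f f') (sym e₁) (sym e₂) sw))
      (subst₂ (λ i j → f i ≤ f j) (sym e₁) (sym e₀) a≤m) (subst₂ (λ i j → f i < f j) (sym e₀) (sym e₂) m<b))
  step⇒∼ {f} {f'} (step₂ i sw a<m m≤b) with e₀ , e₁ , e₂ ← base i = rotated-move (toℕ i) {f} {f'}
    (head-move₂ (swapped-nexts⁺ (toℕ i) (subst₂ (λ i j → Swapped i j f f') (sym e₀) (sym e₁) sw))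
      (subst₂ (λ i j → f i < f j) (sym e₀) (sym e₂) a<m) (subst₂ (λ i j → f i ≤ f j) (sym e₂) (sym e₁) m≤b))

  head-step : ∀ {g g' : Fin N → ℕ} {w w'} → tabulate g ≡ w → tabulate g' ≡ w' → w ⟶ w' →
              (Swapped 1F 2F g g' × g 1F ≤ g 0F × g 0F < g 2F) ⊎ (Swapped 0F 1F g g' × g 0F < g 2F × g 2F ≤ g 1F)
  head-step {g} {g'} eq eq' (knuth₁ {m} {a} {b} v a≤m m<b) = inj₁
    (swapped (trans at₁' (sym at₂)) (trans at₂' (sym at₁)) others ,
     subst₂ _≤_ (sym at₁) (sym at₀) a≤m , subst₂ _<_ (sym at₀) (sym at₂) m<b)
    where
    at₀  = ∷-injectiveˡ eq
    at₁  = ∷-injectiveˡ (∷-injectiveʳ eq)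
    at₂  = ∷-injectiveˡ (∷-injectiveʳ (∷-injectiveʳ eq))
    at₁' = ∷-injectiveˡ (∷-injectiveʳ eq')
    at₂' = ∷-injectiveˡ (∷-injectiveʳ (∷-injectiveʳ eq'))
    rest = trans (∷-injectiveʳ (∷-injectiveʳ (∷-injectiveʳ eq'))) (sym (∷-injectiveʳ (∷-injectiveʳ (∷-injectiveʳ eq))))
    others : ∀ {x} → x ≢ 1F → x ≢ 2F → g' x ≡ g x
    others {0F} _ _ = trans (∷-injectiveˡ eq') (sym at₀)
    others {1F} x≢ _ = contradiction refl x≢
    others {2F} _ x≢ = contradiction refl x≢
    others {suc (suc (suc x))} _ _ = tabulate-injective rest x
  head-step {g} {g'} eq eq' (knuth₂ {a} {b} {m} v a<m m≤b) = inj₂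
    (swapped (trans at₀' (sym at₁)) (trans at₁' (sym at₀)) others ,
     subst₂ _<_ (sym at₀) (sym at₂) a<m , subst₂ _≤_ (sym at₂) (sym at₁) m≤b)
    where
    at₀  = ∷-injectiveˡ eq
    at₁  = ∷-injectiveˡ (∷-injectiveʳ eq)
    at₂  = ∷-injectiveˡ (∷-injectiveʳ (∷-injectiveʳ eq))
    at₀' = ∷-injectiveˡ eq'
    at₁' = ∷-injectiveˡ (∷-injectiveʳ eq')
    rest = trans (∷-injectiveʳ (∷-injectiveʳ (∷-injectiveʳ eq'))) (sym (∷-injectiveʳ (∷-injectiveʳ (∷-injectiveʳ eq))))
    others : ∀ {x} → x ≢ 0F → x ≢ 1F → g' x ≡ g x
    others {0F} x≢ _ = contradiction refl x≢
    others {1F} _ x≢ = contradiction refl x≢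
    others {2F} _ _ = trans (∷-injectiveˡ (∷-injectiveʳ (∷-injectiveʳ eq'))) (sym at₂)
    others {suc (suc (suc x))} _ _ = tabulate-injective rest x

  move⇒step : ∀ k {f f' : Fin N → ℕ} {w w'} → tabulate (f ∘ nexts k) ≡ w → tabulate (f' ∘ nexts k) ≡ w' → w ⟶ w' → Step f f'
  move⇒step k {f} {f'} eq eq' mv with head-step eq eq' mv
  ... | inj₁ (sw , a≤m , m<b) = step₁ (nexts k 0F)
    (subst₂ (λ i j → Swapped i j f f') e₁ e₂ (swapped-nexts⁻ k sw))
    (subst (λ i → f i ≤ f (nexts k 0F)) e₁ a≤m) (subst (λ j → f (nexts k 0F) < f j) e₂ m<b)
    where
    e₁ = nexts-next k 0F
    e₂ = trans (nexts-next k 1F) (cong next e₁)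
  ... | inj₂ (sw , a<m , m≤b) = step₂ (nexts k 0F)
    (subst (λ j → Swapped (nexts k 0F) j f f') e₁ (swapped-nexts⁻ k sw))
    (subst (λ j → f (nexts k 0F) < f j) e₂ a<m) (subst₂ (λ i j → f i ≤ f j) e₂ e₁ m≤b)
    where
    e₁ = nexts-next k 0F
    e₂ = trans (nexts-next k 1F) (cong next e₁)

  -- The exchange can affect ascents only at `prev i`, `i` and `next i`. At `i` the word `f` has one
  -- already; a new one at `prev i` or at `next i` would make that neighbour a witness of the kind
  -- excluded by `¬before` or `¬after`.
  unwitnessed : ∀ {i} {f f' : Fin N → ℕ} → Swapped i (next i) f f' → Ascent f i →
    ¬ (f i ≤ f (prev i) × f (prev i) < f (next i)) → ¬ (f i < f (next (next i)) × f (next (next i)) ≤ f (next i)) →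
    Ascent f' ⊆ Ascent f
  unwitnessed {i} {f} {f'} (swapped first second others) a<b ¬before ¬after {x} asc with x Fin.≟ i | x Fin.≟ next i
  ... | yes refl | _ = a<b
  ... | no _ | yes refl = ≰⇒> λ m≤b → ¬after
    (subst₂ _<_ second (others (next²-≢ i) (next-≢ (next i))) asc , m≤b)
  ... | no x≢i | no x≢j with next x Fin.≟ i
  ... | yes refl = subst (λ p → f p < f (next x)) prev-next (≰⇒> λ a≤m → ¬before (a≤m , m<b))
    where
    prev-next : prev (next x) ≡ x
    prev-next = next-injective (next-prev (next x))
    m<b : f (prev (next x)) < f (next (next x))
    m<b = subst₂ _<_ (trans (others x≢i x≢j) (cong f (sym prev-next))) first asc
  ... | no y≢i = subst₂ _<_ (others x≢i x≢j) (others y≢i (x≢i ∘ next-injective)) asc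

  ascents⇒step : ∀ {i} {f f' : Fin N → ℕ} → Swapped i (next i) f f' → Ascent f i → ¬ (Ascent f' ⊆ Ascent f) → Step f f'
  ascents⇒step {i} {f} {f'} sw a<b ⊈
    with (f i ≤? f (prev i)) ×-dec (f (prev i) <? f (next i)) | (f i <? f (next (next i))) ×-dec (f (next (next i)) ≤? f (next i))
  ... | yes (a≤m , m<b) | _ = step₁ (prev i)
    (subst (λ i → Swapped i (next i) f f') (sym (next-prev i)) sw)
    (subst (λ i' → f i' ≤ f (prev i)) (sym (next-prev i)) a≤m)
    (subst (λ i' → f (prev i) < f (next i')) (sym (next-prev i)) m<b)
  ... | no _ | yes (a<m , m≤b) = step₂ i sw a<m m≤b
  ... | no ¬before | no ¬after = contradiction (λ {x} → unwitnessed sw a<b ¬before ¬after {x}) ⊈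

  step⇒swapped : ∀ {f f' : Fin N → ℕ} → Step f f' → ∃ λ i → Swapped i (next i) f f'
  step⇒swapped (step₁ p sw _ _) = next p , sw
  step⇒swapped (step₂ i sw _ _) = i , sw

  step⇒⊈ : ∀ {f f' : Fin N → ℕ} → Step f f' → ¬ (Ascent f ⊆ Ascent f')
  step⇒⊈ (step₁ p (swapped first second _) a≤m m<b) inc =
    <-asym a<b (subst₂ _<_ first second (inc {next p} a<b))
    where a<b = ≤-<-trans a≤m m<b
  step⇒⊈ (step₂ i (swapped first second _) a<m m≤b) inc =
    <-asym a<b (subst₂ _<_ first second (inc {i} a<b))
    where a<b = <-≤-trans a<m m≤b

  -- The third letter provides the new ascent: at `p` in the first case, at `next i` in the second.
  step⇒⊉ : ∀ {f f' : Fin N → ℕ} → Step f f' → ¬ (Ascent f' ⊆ Ascent f)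
  step⇒⊉ (step₁ p (swapped first _ others) a≤m m<b) inc = ≤⇒≯ a≤m
    (inc {p} (subst₂ _<_ (sym (others (next-≢ p ∘ sym) (next²-≢ p ∘ sym))) (sym first) m<b))
  step⇒⊉ (step₂ i (swapped _ second others) a<m m≤b) inc = ≤⇒≯ m≤b
    (inc {next i} (subst₂ _<_ (sym second) (sym (others (next²-≢ i) (next-≢ (next i)))) a<m))

-- Knuth moves of tabloids and moves of their words

module _ {m : ℕ} {lam : Partition (suc m)} where

  τ⇒ascent : ∀ (T : Tabloid lam) {i} → τ T i → Ascent (letter T) i
  τ⇒ascent T (r , s , i∈r , j∈s , r<s) = subst₂ _<_ (sym (∈row⇒letter T i∈r)) (sym (∈row⇒letter T j∈s)) r<s

  ascent⇒τ : ∀ (T : Tabloid lam) {i} → Ascent (letter T) i → τ T i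
  ascent⇒τ T {i} a<b = _ , _ , proj₂ (row-of T i) , proj₂ (row-of T (next i)) , a<b

  exchanged⇒swapped : ∀ {i j} {T T' : Tabloid lam} → Exchanged i j T T' → Swapped i j (letter T) (letter T')
  exchanged⇒swapped {i} {j} {T} {T'} ex = swapped-transpose λ x →
    sym (∈row⇒letter T (Equivalence.to (ex _ x) (proj₂ (row-of T' x))))

  swapped⇒exchanged : ∀ {i j} {T T' : Tabloid lam} → Swapped i j (letter T) (letter T') → Exchanged i j T T'
  swapped⇒exchanged {i} {j} {T} {T'} sw r x = mk⇔
    (λ x∈ → letter⇒∈row T (trans (sym (transpose-swapped sw x)) (∈row⇒letter T' x∈)))
    (λ y∈ → letter⇒∈row T' (trans (transpose-swapped sw x) (∈row⇒letter T y∈)))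

  τ-⊆⇒ascents-⊆ : ∀ {T T' : Tabloid lam} → τ T ⊆ τ T' → Ascent (letter T) ⊆ Ascent (letter T')
  τ-⊆⇒ascents-⊆ {T} {T'} inc {x} a<b = τ⇒ascent T' (inc (ascent⇒τ T {x} a<b))

  ascents-⊆⇒τ-⊆ : ∀ {T T' : Tabloid lam} → Ascent (letter T) ⊆ Ascent (letter T') → τ T ⊆ τ T'
  ascents-⊆⇒τ-⊆ {T} {T'} inc {x} x∈ = ascent⇒τ T' (inc {x} (τ⇒ascent T x∈))

module _ {m : ℕ} {lam : Partition (suc (suc (suc m)))} where

  step⇒knuth : ∀ {T T' : Tabloid lam} → Step (letter T) (letter T') → KnuthMove T T'
  step⇒knuth {T} {T'} st =
    (proj₁ (step⇒swapped st) , swapped⇒exchanged {T = T} {T'} (proj₂ (step⇒swapped st))) ,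
    (λ inc → step⇒⊈ st (λ {x} → τ-⊆⇒ascents-⊆ {T = T} {T'} inc {x})) ,
    (λ inc → step⇒⊉ st (λ {x} → τ-⊆⇒ascents-⊆ {T = T'} {T} inc {x}))

  knuth⇒∼ : ∀ (T T' : Tabloid lam) → KnuthMove T T' → word T ∼ word T'
  knuth⇒∼ T T' ((i , ex) , T⊈T' , T'⊈T)
    with sw ← exchanged⇒swapped {T = T} {T'} ex | <-cmp (letter T i) (letter T (next i))
  ... | tri< a<b _ _ = step⇒∼ (ascents⇒step sw a<b (λ inc → T'⊈T (ascents-⊆⇒τ-⊆ {T = T'} {T} (λ {x} → inc {x}))))
  -- The ascent at the exchanged pair belongs to `T'`, so the step goes from `T'` to `T`.
  ... | tri> _ _ b<a = step⇒∼ (ascents⇒step (swapped-sym sw)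
    (subst₂ _<_ (sym (Swapped.first sw)) (sym (Swapped.second sw)) b<a)
    (λ inc → T⊈T' (ascents-⊆⇒τ-⊆ {T = T} {T'} (λ {x} → inc {x})))) ⁻¹
  ... | tri≈ _ a≡b _ = ≡⇒∼ (tabulate-cong λ x → sym (same x (x Fin.≟ i) (x Fin.≟ next i)))
    where
    same : ∀ x → Dec (x ≡ i) → Dec (x ≡ next i) → letter T' x ≡ letter T x
    same x (yes refl) _          = trans (Swapped.first sw) (sym a≡b)
    same x (no _)     (yes refl) = trans (Swapped.second sw) a≡b
    same x (no x≢i)   (no x≢j)   = Swapped.others sw x≢i x≢j

  connected⇒∼ : ∀ {T T' : Tabloid lam} → SameComponent T T' → word T ∼ word T'
  connected⇒∼ ε                            = refl
  connected⇒∼ {T} (_◅_ {j = T'} (fwd kn) kns) = knuth⇒∼ T T' kn ⨾ connected⇒∼ kns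
  connected⇒∼ {T} (_◅_ {j = T'} (bwd kn) kns) = knuth⇒∼ T' T kn ⁻¹ ⨾ connected⇒∼ kns

  -- A `turn` rotates words, but tabloids have fixed positions. The turns met so far are therefore
  -- accumulated in `k`, while `T` and `T'` stay the same.
  ∼⇒connected′ : ∀ {w w'} → w ∼ w' → ∀ k (T T' : Tabloid lam) →
                 word T ≡ rotations k w → word T' ≡ rotations k w' → SameComponent T T'
  ∼⇒connected′ {w} {w'} (move mv) k T T' eq eq' =
    -- With `n = m + 3`, a further `k * (n - 1)` rotations complete `k` to `k * n`, a number of full
    -- circles, and bring the move to the front.
    EqClosure.return (step⇒knuth {T} {T'} (move⇒step (k * suc (suc m)) {letter T} {letter T'} (undo {T = T} w eq) (undo {T = T'} w' eq') mv))
    where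
    undo : ∀ {T : Tabloid lam} w → word T ≡ rotations k w → tabulate (letter T ∘ nexts (k * suc (suc m))) ≡ w
    undo {T} w eq = begin
      tabulate (letter T ∘ nexts (k * suc (suc m)))    ≡⟨ tabulate-nexts (k * suc (suc m)) (letter T) ⟩
      rotations (k * suc (suc m)) (word T)             ≡⟨ cong (rotations (k * suc (suc m))) eq ⟩
      rotations (k * suc (suc m)) (rotations k w)      ≡⟨ rotations-+ (k * suc (suc m)) k w ⟨
      rotations (k * suc (suc m) + k) w                ≡⟨ cong (λ j → rotations j w) (trans (+-comm _ k) (sym (*-suc k (suc (suc m))))) ⟩
      rotations (k * suc (suc (suc m))) w              ≡⟨ cong (λ j → rotations (k * j) w) same-length ⟩
      rotations (k * length w) w                       ≡⟨ rotations-multiple k w ⟩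
      w                                                ∎
      where
      open ≡-Reasoning
      same-length : suc (suc (suc m)) ≡ length w
      same-length = trans (sym (length-tabulate (letter T))) (trans (cong length eq) (↭-length (rotations-↭ k w)))
  ∼⇒connected′ refl k T T' eq eq' with refl ← letters-≡⇒≡ {T = T} {T'} (tabulate-injective (trans eq (sym eq'))) = ε
  ∼⇒connected′ (p ⁻¹) k T T' eq eq' = EqClosure.symmetric _ (∼⇒connected′ p k T' T eq' eq)
  ∼⇒connected′ (_⨾_ {u} {v} p q) k T T' eq eq' =
    EqClosure.transitive _ (∼⇒connected′ p k T T'' eq eq'') (∼⇒connected′ q k T'' T' eq'' eq')
    where
    T↭v : word T ↭ rotations k v
    T↭v = subst (_↭ rotations k v) (sym eq) (↭-trans (rotations-↭ k u) (↭-trans (∼⇒↭ p) (↭-sym (rotations-↭ k v))))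
    middle : ∃ λ (T'' : Tabloid lam) → word T'' ≡ rotations k v
    middle = realise lam (rotations k v)
      (trans (↭-length (↭-sym T↭v)) (length-tabulate (letter T))) (content-↭ {parts lam} T↭v (word-content T))
    T''  = proj₁ middle
    eq'' = proj₂ middle
  ∼⇒connected′ (turn {w} {w'} p) k T T' eq eq' = ∼⇒connected′ p (suc k) T T'
    (trans eq (rotations-rotate k w)) (trans eq' (rotations-rotate k w'))

  connected⇔charge : ∀ (T T' : Tabloid lam) → SameComponent T T' ⇔ (charge T ≡ charge T' [mod d lam ])
  connected⇔charge T T' = mk⇔
    (λ conn → congruent⇒mod (congruent-trans (charge-word T)
      (congruent-trans (Equivalence.to words (connected⇒∼ {T} {T'} conn)) (congruent-sym (charge-word T')))))
    (λ mod → ∼⇒connected′ (Equivalence.from words (congruent-trans (congruent-sym (charge-word T))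
      (congruent-trans (mod⇒congruent mod) (charge-word T')))) 0 T T' refl refl)
    where
    words : word T ∼ word T' ⇔ Congruent (d lam) (wordCharge (#parts lam) (word T)) (wordCharge (#parts lam) (word T'))
    words = connected⇔congruent (parts-decreasing lam) (word-content T) (word-content T')

-- Fewer than three cells

single-row : ∀ {n} {lam : Partition n} → #parts lam ≡ 1 → ∀ (T T' : Tabloid lam) → T ≡ T'
single-row one T T' = letters-≡⇒≡ λ x →
  trans (n<1⇒n≡0 (subst (letter T x <_) one (toℕ<n (proj₁ (row-of T x)))))
        (sym (n<1⇒n≡0 (subst (letter T' x <_) one (toℕ<n (proj₁ (row-of T' x))))))

single-row-connected⇔charge : ∀ {n} .{{_ : NonZero n}} {lam : Partition n} → #parts lam ≡ 1 →
         ∀ (T T' : Tabloid lam) → SameComponent T T' ⇔ (charge T ≡ charge T' [mod d lam ])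
single-row-connected⇔charge one T T' with refl ← single-row one T T' = mk⇔ (λ _ → congruent⇒mod (≡⇒congruent {a = charge T} refl)) (λ _ → ε)

few-cells : ∀ ps → All NonZero ps → sum ps ≡ 1 ⊎ sum ps ≡ 2 → ps ≢ 1 ∷ 1 ∷ [] → length ps ≡ 1
few-cells []           _               (inj₁ ()) _
few-cells []           _               (inj₂ ()) _
few-cells (p ∷ [])     _               _         _ = refl
few-cells (suc zero ∷ suc zero ∷ []) _ _ ≢ = contradiction refl ≢
few-cells (suc zero ∷ suc zero ∷ suc r ∷ ps) _ (inj₁ ()) _
few-cells (suc zero ∷ suc zero ∷ suc r ∷ ps) _ (inj₂ ()) _
few-cells (suc zero ∷ suc (suc q) ∷ ps) _ (inj₁ ()) _
few-cells (suc zero ∷ suc (suc q) ∷ ps) _ (inj₂ ()) _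
few-cells (suc (suc p) ∷ suc q ∷ ps) _ (inj₁ ()) _
few-cells (suc (suc p) ∷ suc q ∷ ps) _ (inj₂ eq) _ =
  contradiction (trans (sym (+-suc p (q + sum ps))) (suc-injective (suc-injective eq))) λ ()
few-cells (suc zero ∷ suc zero ∷ zero ∷ ps) (_ ∷ _ ∷ () ∷ _) _ _
few-cells (zero ∷ q ∷ ps) (() ∷ _) _ _
few-cells (p ∷ zero ∷ ps) (_ ∷ () ∷ _) _ _

-- The shape `1 ∷ 1 ∷ []` is a genuine exception. Its two tabloids have different one-element sets
-- `τ` and are joined by a Knuth move, yet their charges are 0 and 1 while `d` is 2. The other
-- shapes with at most two cells have a single row, hence a single tabloid.
theorem8p6 : (n : ℕ) .{{_ : NonZero n}} (lam : Partition n) → parts lam ≢ 1 ∷ 1 ∷ [] → (T T' : Tabloid lam) → SameComponent T T' ⇔ (charge T ≡ charge T' [mod d lam ])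
theorem8p6 1 lam ≢ = single-row-connected⇔charge (few-cells (parts lam) (Partition.positive lam) (inj₁ (Partition.total lam)) ≢)
theorem8p6 2 lam ≢ = single-row-connected⇔charge (few-cells (parts lam) (Partition.positive lam) (inj₂ (Partition.total lam)) ≢)
theorem8p6 (suc (suc (suc m))) lam _ = connected⇔charge
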